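{- Let $d=(d_1,\dots,d_n)$ be a graphic list, and let $P(d)\subseteq\mathbb{R}^{\binom{n}{2}}$ be the polytope of all $x=(x_{ij})$ (indexed by unordered pairs of distinct elements of $[n]$) with $\sum_{i\neq j}x_{ij}=d_j$ for all $j\in[n]$ and $0\le x_{ij}\le 1$ for all $i<j$. The following are equivalent: (1) $d$ is decisive, i.e., every vertex of $P(d)$ has all coordinates in $\{0,1\}$; (2) no realization of $d$ contains an integral $(k,\ell)$-blossom for any odd integers $k,\ell\ge 3$; (3) no realization of $d$ contains an integral $(3,3)$-blossom.
   Context: A realization of $d$ is a simple graph on vertex set $[n]$ in which vertex $i$ has degree $d_i$ for every $i$. For odd integers $k,\ell\ge3$, an integral $(k,\ell)$-blossom in a simple graph $G$ consists of $k+\ell$ distinct vertices $v_1,\dots,v_k,w_1,\dots,w_\ell$ such that, in the sequence of vertex pairs $$v_1v_2,\ v_2v_3,\ \dots,\ v_{k-1}v_k,\ v_kv_1,\ v_1w_1,\ w_1w_2,\ w_2w_3,\ \dots,\ w_{\ell-1}w_\ell,\ w_\ell w_1,$$ consecutive pairs alternate between being non-edges and edges of $G$ (the pair $v_1w_1$ may be either an edge or a non-edge). Nothing is required of other pairs among these vertices.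
   Formalization: The polytope P(d) is taken over the rationals: its points have rational coordinates and a vertex is an extreme point among the rational points; as P(d) is defined by integer constraints, these are exactly the vertices of the real polytope. -}

module Defs where

open import Data.Nat using (ℕ; zero; suc; _+_; _*_; _≤_)
open import Data.Bool using (Bool; true; false; if_then_else_)
open import Data.Fin using (Fin)
import Data.Fin as F
open import Data.Fin.Properties using (_<?_)
open import Data.List using (List; []; _∷_; _++_; map; length; foldr)
open import Data.Nat.ListAction using (sum)
import Data.Integer as ℤ
open import Data.List.Relation.Unary.Unique.Propositional using (Unique)
open import Data.List.Base using (allFin)
open import Data.Product using (Σ; ∃; _×_; _,_)
open import Data.Sum using (_⊎_)
open import Data.Unit using (⊤)
open import Relation.Nullary using (¬_; yes; no)
open import Relation.Binary.PropositionalEquality using (_≡_; _≢_)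
open import Data.Rational as Q using (ℚ; 0ℚ; 1ℚ)

record Graph (n : ℕ) : Set where
  field
    adj    : Fin n → Fin n → Bool
    sym    : ∀ i j → adj i j ≡ adj j i
    irrefl : ∀ i → adj i i ≡ false
open Graph public

degree : {n : ℕ} → Graph n → Fin n → ℕ
degree {n} G i = sum (map (λ j → if adj G i j then 1 else 0) (allFin n))

Realizes : {n : ℕ} → Graph n → (Fin n → ℕ) → Set
Realizes G d = ∀ i → degree G i ≡ d i

Graphic : {n : ℕ} → (Fin n → ℕ) → Set
Graphic {n} d = Σ (Graph n) λ G → Realizes G d

Odd : ℕ → Set
Odd k = ∃ λ m → k ≡ suc (2 * m)

-- The vertex walk v1 … vk v1 w1 … wℓ w1 ; its consecutive vertex pairs are
-- exactly v1v2, …, v(k-1)vk, vkv1, v1w1, w1w2, …, w(ℓ-1)wℓ, wℓw1.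
blossomWalk : {n : ℕ} → List (Fin n) → List (Fin n) → List (Fin n)
blossomWalk (v₁ ∷ vs) (w₁ ∷ ws) = v₁ ∷ vs ++ v₁ ∷ w₁ ∷ ws ++ w₁ ∷ []
blossomWalk _ _ = []

Alternating : {n : ℕ} → Graph n → List (Fin n) → Set
Alternating G (x ∷ y ∷ z ∷ rest) =
  (adj G x y ≢ adj G y z) × Alternating G (y ∷ z ∷ rest)
Alternating G _ = ⊤

IntegralBlossom : {n : ℕ} → Graph n → ℕ → ℕ → Set
IntegralBlossom {n} G k ℓ =
  Σ (List (Fin n)) λ vs → Σ (List (Fin n)) λ ws →
    length vs ≡ k × length ws ≡ ℓ × Unique (vs ++ ws) ×
    Alternating G (blossomWalk vs ws)

NoBlossoms : {n : ℕ} → (Fin n → ℕ) → Set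
NoBlossoms {n} d = ∀ (G : Graph n) → Realizes G d → ∀ k ℓ →
  Odd k → 3 ≤ k → Odd ℓ → 3 ≤ ℓ → ¬ IntegralBlossom G k ℓ

NoBlossoms33 : {n : ℕ} → (Fin n → ℕ) → Set
NoBlossoms33 {n} d = ∀ (G : Graph n) → Realizes G d → ¬ IntegralBlossom G 3 3

-- The polytope P(d) (over ℚ)
-- A point is x : Fin n → Fin n → ℚ, where only the coordinates x i j with
-- i < j are meaningful (x_{ij} for the unordered pair {i,j}).

Point : ℕ → Set
Point n = Fin n → Fin n → ℚ

pairVal : {n : ℕ} → Point n → Fin n → Fin n → ℚ
pairVal x i j with i <? j
... | yes _ = x i j
... | no _ with j <? i
...   | yes _ = x j i
...   | no _ = 0ℚ

sumℚ : List ℚ → ℚ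
sumℚ = foldr Q._+_ 0ℚ

degSum : {n : ℕ} → Point n → Fin n → ℚ
degSum {n} x j = sumℚ (map (λ i → pairVal x i j) (allFin n))

InP : {n : ℕ} → (Fin n → ℕ) → Point n → Set
InP {n} d x =
  (∀ (j : Fin n) → degSum x j ≡ (ℤ.+ (d j)) Q./ 1) ×
  (∀ (i j : Fin n) → i F.< j → (0ℚ Q.≤ x i j) × (x i j Q.≤ 1ℚ))

-- vertex = extreme point: not the midpoint of two distinct points of P(d)
IsVertex : {n : ℕ} → (Fin n → ℕ) → Point n → Set
IsVertex {n} d x = InP d x × (∀ (y z : Point n) → InP d y → InP d z →
  (∀ (i j : Fin n) → i F.< j → x i j Q.+ x i j ≡ y i j Q.+ z i j) →
  ∀ (i j : Fin n) → i F.< j → y i j ≡ z i j)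

Decisive : {n : ℕ} → (Fin n → ℕ) → Set
Decisive {n} d = ∀ (x : Point n) → IsVertex d x →
  ∀ (i j : Fin n) → i F.< j → (x i j ≡ 0ℚ) ⊎ (x i j ≡ 1ℚ)

{-# OPTIONS --safe #-}
module Submission where

-- A point of P(d) is a symmetric matrix with zero diagonal, entries in [0,1] and column sums d; a
-- realization is such a matrix with entries 0 and 1.
--
-- (1) ⇒ (2).  Let x be the value of the first and last pair of both odd cycles of a blossom, so that
-- v₁w₁ has value 1 − x.  Putting ½ on both cycles and x on v₁w₁ preserves all degrees, and since the
-- incidence matrix of an odd cycle is nonsingular the new point is a vertex of P(d).
--
-- (3) ⇒ (2).  If a cycle v₁v₂v₃v₄v₅… of a blossom is not a triangle, then v₁v₄v₅… can take its place,
-- possibly after exchanging edges and non-edges along the 4-cycle v₁v₂v₃v₄.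
--
-- (3) ⇒ (1).  Let F be the graph of the pairs with fractional value at a vertex of P(d).  No vertex of
-- F has degree 1, as the degrees are integers, and no nonzero weighting of the edges of F has zero sum
-- at every vertex of F.  So F has at most as many edges as vertices, hence it is 2-regular, and the
-- values of adjacent edges add up to 1.  An even cycle would carry an alternating weighting, so all
-- cycles are odd and all values on F are ½.  The sum of the degrees is even, so F is not a single odd
-- cycle.  Two cycles together with the pair of their base points can be rounded to integers such that
-- no degree changes and they form a blossom; rounding all cycles in this way, two at a time, leads to a
-- realization that contains a blossom.

open import Defs renaming (sym to adj-sym)
open import Data.Nat as ℕ using (ℕ; zero; suc)
import Data.Nat.Properties as ℕ
import Data.Nat.ListAction as ℕ
import Data.Nat.Coprimality as Coprimality
open import Data.Integer as ℤ using (ℤ)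
import Data.Integer.Properties as ℤ
open import Data.Rational as ℚ hiding (_≟_; _<?_)
open import Data.Rational.Properties hiding (_≟_; _<?_; <-cmp)
open import Data.Rational.Solver
open +-*-Solver using (solve; _:+_; _:*_; _:-_; :-_; _:=_; con)
open import Data.Bool as Bool using (Bool; true; false; if_then_else_; not; _∧_; _∨_)
import Data.Bool.Properties as Bool
open import Data.Fin as Fin using (Fin; zero; suc)
open import Data.Fin.Properties as Fin using (_≟_; _<?_; <-cmp; any?)
open import Data.Product using (Σ; ∃; _×_; _,_; proj₁; proj₂)
open import Data.Sum as Sum using (_⊎_; inj₁; inj₂; [_,_]′)
open import Data.Unit using (⊤; tt)
open import Data.Empty using (⊥)
open import Data.List using (List; []; _∷_; _++_; map; length; lookup; allFin; tabulate; filter)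
open import Data.List.Properties using (map-tabulate; ++-assoc)
open import Data.List.Membership.Propositional using (_∈_; _∉_)
open import Data.List.Membership.Propositional.Properties
  using (∈-++⁺ˡ; ∈-++⁺ʳ; ∈-++⁻; ∈-filter⁺; ∈-allFin; ∈-lookup)
open import Data.List.Membership.DecPropositional using (_∈?_)
open import Data.List.Relation.Unary.Any using (here; there; index)
open import Data.List.Relation.Unary.Any.Properties using (lookup-index)
open import Data.List.Relation.Unary.All as All using ([]; _∷_)
import Data.List.Relation.Unary.All.Properties as All
open import Data.List.Relation.Unary.AllPairs as AllPairs using ([]; _∷_)
open import Data.List.Relation.Unary.Unique.Propositional using (Unique)
import Data.List.Relation.Unary.Unique.Propositional.Properties as Unique
open import Relation.Nullary using (¬_; Dec; yes; no; does; contradiction)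
open import Relation.Nullary.Decidable
  using (_×-dec_; _⊎-dec_; dec-true; dec-false; ¬?; decidable-stable)
open import Relation.Binary.PropositionalEquality hiding ([_])
open import Relation.Binary.Definitions using (tri<; tri≈; tri>)
open import Function using (_∘_; id; case_of_)
open import Function.Bundles using (_⇔_; mk⇔)
open import Algebra.Bundles using (CommutativeRing)
open import Algebra.Properties.Semiring.Sum (CommutativeRing.semiring +-*-commutativeRing)
  using (sum; sum-cong-≗; ∑-distrib-+; *-distribˡ-sum)
import Algebra.Properties.Semiring.Sum ℕ.+-*-semiring as ℕ∑
open import Algebra.Properties.Group +-0-group using (⁻¹-involutive)
open ≡-Reasoning

-- Finite sums and integrality

Mat : ℕ → Set
Mat n = Fin n → Fin n → ℚ

private variable
  n : ℕ
  X Y : Mat n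
  a b z : Fin n
  bs : List (Fin n)

ind : Fin n → Fin n → ℚ
ind a i = if does (a ≟ i) then 1ℚ else 0ℚ

ind-refl : (a : Fin n) → ind a a ≡ 1ℚ
ind-refl a with a ≟ a
... | yes _ = refl
... | no a≢a = contradiction refl a≢a

ind-≢ : {a i : Fin n} → a ≢ i → ind a i ≡ 0ℚ
ind-≢ {a = a} {i} a≢i with a ≟ i
... | yes a≡i = contradiction a≡i a≢i
... | no _ = refl

sum-zero : (f : Fin n → ℚ) → (∀ i → f i ≡ 0ℚ) → sum f ≡ 0ℚ
sum-zero {zero} f f≡0 = refl
sum-zero {suc n} f f≡0 = cong₂ _+_ (f≡0 zero) (sum-zero (f ∘ suc) (f≡0 ∘ suc))

sum-one : (f : Fin n → ℚ) (a : Fin n) → (∀ i → i ≢ a → f i ≡ 0ℚ) → sum f ≡ f a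
sum-one f zero f≡0 =
  trans (cong (f zero +_) (sum-zero (f ∘ suc) λ i → f≡0 (suc i) λ ())) (+-identityʳ _)
sum-one f (suc a) f≡0 =
  trans (cong₂ _+_ (f≡0 zero λ ()) (sum-one (f ∘ suc) a λ i i≢a → f≡0 (suc i) λ { refl → i≢a refl }))
        (+-identityˡ _)

sum-ind-* : (a : Fin n) (f : Fin n → ℚ) → sum (λ i → ind a i * f i) ≡ f a
sum-ind-* a f = begin
  sum (λ i → ind a i * f i) ≡⟨ sum-one _ a (λ i i≢a → trans (cong (_* f i) (ind-≢ (i≢a ∘ sym))) (*-zeroˡ (f i))) ⟩
  ind a a * f a             ≡⟨ cong (_* f a) (ind-refl a) ⟩
  1ℚ * f a                  ≡⟨ *-identityˡ (f a) ⟩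
  f a                       ∎

sum-two : (f : Fin n → ℚ) {a b : Fin n} → a ≢ b → (∀ i → i ≢ a → i ≢ b → f i ≡ 0ℚ) → sum f ≡ f a + f b
sum-two f {a} {b} a≢b f≡0 = begin
  sum f                                                       ≡⟨ sum-cong-≗ split ⟩
  sum (λ i → ind a i * f i + ind b i * f i)                   ≡⟨ ∑-distrib-+ (λ i → ind a i * f i) (λ i → ind b i * f i) ⟩
  sum (λ i → ind a i * f i) + sum (λ i → ind b i * f i)       ≡⟨ cong₂ _+_ (sum-ind-* a f) (sum-ind-* b f) ⟩
  f a + f b                                                   ∎
  where
  split : ∀ i → f i ≡ ind a i * f i + ind b i * f i
  split i with a ≟ i | b ≟ i
  ... | yes refl | yes refl = contradiction refl a≢b
  ... | yes refl | no _ = solve 1 (λ x → x := con 1ℚ :* x :+ con 0ℚ :* x) refl (f i)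
  ... | no _ | yes refl = solve 1 (λ x → x := con 0ℚ :* x :+ con 1ℚ :* x) refl (f i)
  ... | no a≢i | no b≢i =
    trans (f≡0 i (a≢i ∘ sym) (b≢i ∘ sym)) (solve 1 (λ x → con 0ℚ := con 0ℚ :* x :+ con 0ℚ :* x) refl (f i))

ι : ℤ → ℚ
ι z = z / 1

IsInt : ℚ → Set
IsInt q = ∃ λ z → q ≡ ι z

private
  coprime-1 : ∀ z → Coprimality.Coprime ℤ.∣ z ∣ 1
  coprime-1 z = Coprimality.sym (Coprimality.1-coprimeTo ℤ.∣ z ∣)

  ι-mkℚ : ∀ z → ι z ≡ mkℚ z 0 (coprime-1 z)
  ι-mkℚ z = ↥p/↧p≡p (mkℚ z 0 (coprime-1 z))

ι-+ : ∀ a b → ι (a ℤ.+ b) ≡ ι a + ι b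
ι-+ a b = sym (begin
  ι a + ι b                                           ≡⟨ cong₂ _+_ (ι-mkℚ a) (ι-mkℚ b) ⟩
  mkℚ a 0 (coprime-1 a) + mkℚ b 0 (coprime-1 b)       ≡⟨⟩
  ι (a ℤ.* ℤ.1ℤ ℤ.+ b ℤ.* ℤ.1ℤ)                       ≡⟨ cong ι (cong₂ ℤ._+_ (ℤ.*-identityʳ a) (ℤ.*-identityʳ b)) ⟩
  ι (a ℤ.+ b)                                         ∎)

ι-cancel-≤ : ∀ {a b} → ι a ≤ ι b → a ℤ.≤ b
ι-cancel-≤ {a} {b} p with subst₂ _≤_ (ι-mkℚ a) (ι-mkℚ b) p
... | *≤* q = subst₂ ℤ._≤_ (ℤ.*-identityʳ a) (ℤ.*-identityʳ b) q

ι-cancel-< : ∀ {a b} → ι a < ι b → a ℤ.< b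
ι-cancel-< {a} {b} p with subst₂ _<_ (ι-mkℚ a) (ι-mkℚ b) p
... | *<* q = subst₂ ℤ._<_ (ℤ.*-identityʳ a) (ℤ.*-identityʳ b) q

ι-injective : ∀ {a b} → ι a ≡ ι b → a ≡ b
ι-injective p = ℤ.≤-antisym (ι-cancel-≤ (≤-reflexive p)) (ι-cancel-≤ (≤-reflexive (sym p)))

IsInt-0 : IsInt 0ℚ
IsInt-0 = ℤ.0ℤ , refl

IsInt-1 : IsInt 1ℚ
IsInt-1 = ℤ.1ℤ , refl

IsInt-+ : ∀ {p q} → IsInt p → IsInt q → IsInt (p + q)
IsInt-+ (a , refl) (b , refl) = a ℤ.+ b , sym (ι-+ a b)

IsInt-cancelʳ : ∀ {p q} → IsInt (p + q) → IsInt q → IsInt p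
IsInt-cancelʳ {p} (a , p+q≡a) (b , refl) = a ℤ.- b , (begin
  p                       ≡⟨ solve 2 (λ x y → x := (x :+ y) :- y) refl p (ι b) ⟩
  (p + ι b) - ι b         ≡⟨ cong (_- ι b) p+q≡a ⟩
  ι a - ι b               ≡⟨ cong (λ c → ι c - ι b) (sym (trans (ℤ.+-assoc a (ℤ.- b) b) (trans (cong (λ c → a ℤ.+ c) (ℤ.+-inverseˡ b)) (ℤ.+-identityʳ a)))) ⟩
  ι (a ℤ.- b ℤ.+ b) - ι b ≡⟨ cong (_- ι b) (ι-+ (a ℤ.- b) b) ⟩
  ι (a ℤ.- b) + ι b - ι b ≡⟨ solve 2 (λ x y → (x :+ y) :- y := x) refl (ι (a ℤ.- b)) (ι b) ⟩
  ι (a ℤ.- b)             ∎)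

IsInt-sum : (f : Fin n → ℚ) → (∀ i → IsInt (f i)) → IsInt (sum f)
IsInt-sum {zero} f int = IsInt-0
IsInt-sum {suc n} f int = IsInt-+ (int zero) (IsInt-sum (f ∘ suc) (int ∘ suc))

int-01 : ∀ {q} → IsInt q → 0ℚ ≤ q → q ≤ 1ℚ → q ≡ 0ℚ ⊎ q ≡ 1ℚ
int-01 (z , refl) p q with z | ι-cancel-≤ {ℤ.0ℤ} {z} p | ι-cancel-≤ {z} {ℤ.1ℤ} q
... | ℤ.+ 0 | _ | _ = inj₁ refl
... | ℤ.+ 1 | _ | _ = inj₂ refl
... | ℤ.+ suc (suc _) | _ | ℤ.+≤+ (ℕ.s≤s ())
... | ℤ.-[1+ _ ] | () | _

-- Applied to the sum of two fractional values in one column.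
int-strictly-02 : ∀ {q} → IsInt q → 0ℚ < q → q < 1ℚ + 1ℚ → q ≡ 1ℚ
int-strictly-02 (z , refl) p q with z | ι-cancel-< {ℤ.0ℤ} {z} p | ι-cancel-< {z} {ℤ.+ 2} q
... | ℤ.+ 0 | ℤ.+<+ () | _
... | ℤ.+ 1 | _ | _ = refl
... | ℤ.+ suc (suc _) | _ | ℤ.+<+ (ℕ.s≤s (ℕ.s≤s ()))
... | ℤ.-[1+ _ ] | () | _

-- Symmetric matrices and alternating paths

record Symm (X : Mat n) : Set where
  field
    comm : ∀ i j → X i j ≡ X j i
    diag : ∀ i → X i i ≡ 0ℚ
open Symm public

colsum : Mat n → Fin n → ℚ
colsum X j = sum (λ i → X i j)

Pair : Fin n → Fin n → Fin n → Fin n → Set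
Pair a b i j = (i ≡ a × j ≡ b) ⊎ (i ≡ b × j ≡ a)

pair? : (a b i j : Fin n) → Dec (Pair a b i j)
pair? a b i j = ((i ≟ a) ×-dec (j ≟ b)) ⊎-dec ((i ≟ b) ×-dec (j ≟ a))

Pair-swap : {i j : Fin n} → Pair a b i j → Pair a b j i
Pair-swap (inj₁ (p , q)) = inj₂ (q , p)
Pair-swap (inj₂ (p , q)) = inj₁ (q , p)

set : Fin n → Fin n → ℚ → Mat n → Mat n
set a b v X i j with pair? a b i j
... | yes _ = v
... | no _ = X i j

-- `P` sees the position as well as the value, so one principle serves claims about values (bounds,
-- integrality) and claims about where a matrix has changed.
set-elim : (P : Fin n → Fin n → ℚ → Set) {v : ℚ} → P a b v → P b a v →
  (∀ i j → P i j (X i j)) → ∀ i j → P i j (set a b v X i j)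
set-elim {a = a} {b} P pab pba pX i j with pair? a b i j
... | yes (inj₁ (refl , refl)) = pab
... | yes (inj₂ (refl , refl)) = pba
... | no _ = pX i j

set-hit : (a b : Fin n) (v : ℚ) (X : Mat n) → set a b v X a b ≡ v
set-hit a b v X with pair? a b a b
... | yes _ = refl
... | no ¬p = contradiction (inj₁ (refl , refl)) ¬p

set-miss : (a b : Fin n) (v : ℚ) (X : Mat n) {i j : Fin n} → ¬ Pair a b i j → set a b v X i j ≡ X i j
set-miss a b v X {i} {j} ¬p with pair? a b i j
... | yes p = contradiction p ¬p
... | no _ = refl

set-Symm : {v : ℚ} → a ≢ b → Symm X → Symm (set a b v X)
set-Symm {a = a} {b} a≢b sX .comm i j with pair? a b i j | pair? a b j i
... | yes _ | yes _ = refl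
... | yes p | no ¬q = contradiction (Pair-swap p) ¬q
... | no ¬p | yes q = contradiction (Pair-swap q) ¬p
... | no _ | no _ = sX .comm i j
set-Symm {a = a} {b} a≢b sX .diag i with pair? a b i i
... | yes (inj₁ (refl , refl)) = contradiction refl a≢b
... | yes (inj₂ (refl , refl)) = contradiction refl a≢b
... | no _ = sX .diag i

ind-*-zero : {i j : Fin n} → ¬ (i ≡ a × j ≡ b) → ind a i * ind b j ≡ 0ℚ
ind-*-zero {a = a} {b} {i} {j} ¬p with a ≟ i | b ≟ j
... | yes refl | yes refl = contradiction (refl , refl) ¬p
... | yes _ | no _ = refl
... | no _ | yes _ = refl
... | no _ | no _ = refl

-- Changing one pair is written as adding a multiple of its indicator matrix, so that the effect on
-- column sums follows by linearity.
set-+ : {v : ℚ} → a ≢ b → Symm X → ∀ i j →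
  set a b v X i j ≡ X i j + (v - X a b) * (ind a i * ind b j + ind b i * ind a j)
set-+ {a = a} {b} {X = X} {v} a≢b sX i j with pair? a b i j
... | yes (inj₁ (refl , refl)) rewrite ind-refl a | ind-refl b | ind-≢ a≢b =
  solve 3 (λ v x y → v := x :+ (v :- x) :* (con 1ℚ :* con 1ℚ :+ y :* con 0ℚ)) refl v (X a b) (ind b a)
... | yes (inj₂ (refl , refl)) rewrite ind-refl a | ind-refl b | ind-≢ a≢b | sX .comm b a =
  solve 3 (λ v x y → v := x :+ (v :- x) :* (con 0ℚ :* y :+ con 1ℚ :* con 1ℚ)) refl v (X a b) (ind b a)
... | no ¬p = begin
  X i j                                  ≡⟨ solve 2 (λ x s → x := x :+ s :* (con 0ℚ :+ con 0ℚ)) refl (X i j) (v - X a b) ⟩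
  X i j + (v - X a b) * (0ℚ + 0ℚ)        ≡⟨ cong₂ (λ s t → X i j + (v - X a b) * (s + t)) (sym (ind-*-zero (¬p ∘ inj₁))) (sym (ind-*-zero (¬p ∘ inj₂))) ⟩
  X i j + (v - X a b) * (ind a i * ind b j + ind b i * ind a j) ∎

set-colsum : {v : ℚ} → a ≢ b → Symm X → ∀ j →
  colsum (set a b v X) j ≡ colsum X j + (v - X a b) * (ind a j + ind b j)
set-colsum {a = a} {b} {X = X} {v} a≢b sX j = begin
  colsum (set a b v X) j
    ≡⟨ sum-cong-≗ (λ i → set-+ {v = v} a≢b sX i j) ⟩
  sum (λ i → X i j + s * (ind a i * ind b j + ind b i * ind a j))
    ≡⟨ ∑-distrib-+ (λ i → X i j) (λ i → s * (ind a i * ind b j + ind b i * ind a j)) ⟩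
  colsum X j + sum (λ i → s * (ind a i * ind b j + ind b i * ind a j))
    ≡⟨ cong (colsum X j +_) (sym (*-distribˡ-sum s (λ i → ind a i * ind b j + ind b i * ind a j))) ⟩
  colsum X j + s * sum (λ i → ind a i * ind b j + ind b i * ind a j)
    ≡⟨ cong (λ t → colsum X j + s * t) (trans (∑-distrib-+ (λ i → ind a i * ind b j) (λ i → ind b i * ind a j))
         (cong₂ _+_ (sum-ind-* a λ _ → ind b j) (sum-ind-* b λ _ → ind a j))) ⟩
  colsum X j + s * (ind b j + ind a j)
    ≡⟨ cong (λ t → colsum X j + s * t) (+-comm (ind b j) (ind a j)) ⟩
  colsum X j + s * (ind a j + ind b j) ∎
  where
  s = v - X a b

verts : Fin n → List (Fin n) → Fin n → List (Fin n)
verts a bs z = a ∷ bs ++ z ∷ []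

Chain : (Fin n → Fin n → Set) → Fin n → List (Fin n) → Fin n → Set
Chain E a [] z = E a z
Chain E a (b ∷ bs) z = E a b × Chain E b bs z

Chain-map : {E F : Fin n → Fin n → Set} → (∀ {i j} → E i j → F i j) → ∀ a bs z → Chain E a bs z → Chain F a bs z
Chain-map f a [] z e = f e
Chain-map f a (b ∷ bs) z (e , c) = f e , Chain-map f b bs z c

Chain-zip : {E F : Fin n → Fin n → Set} → ∀ a bs z → Chain E a bs z → Chain F a bs z → Chain (λ i j → E i j × F i j) a bs z
Chain-zip a [] z e f = e , f
Chain-zip a (b ∷ bs) z (e , c) (f , d) = (e , f) , Chain-zip b bs z c d

Chain-∈ : ∀ (a : Fin n) bs z → Chain (λ i j → i ∈ verts a bs z × j ∈ verts a bs z) a bs z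
Chain-∈ a [] z = here refl , there (here refl)
Chain-∈ a (b ∷ bs) z = (here refl , there (here refl)) , Chain-map (λ (p , q) → there p , there q) b bs z (Chain-∈ b bs z)

-- In a cycle this separates the pair of two neighbours from all other pairs: both of its vertices
-- lie on the remaining path, but only as the ends of that path.
Chain-interior : ∀ (a b : Fin n) bs z → Chain (λ i j → i ∈ b ∷ bs ⊎ j ∈ b ∷ bs) a (b ∷ bs) z
Chain-interior a b [] z = inj₂ (here refl) , inj₁ (here refl)
Chain-interior a b (c ∷ bs) z =
  inj₂ (here refl) , Chain-map (Sum.map there there) b (c ∷ bs) z (Chain-interior b c bs z)

-- The values may be fractional; for `v` equal to `½` the condition says that the path is constantly
-- `½`.
AltM : Mat n → ℚ → Fin n → List (Fin n) → Fin n → Set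
AltM X v a [] z = X a z ≡ v
AltM X v a (b ∷ bs) z = X a b ≡ v × AltM X (1ℚ - v) b bs z

AltM-cong : ∀ v (a : Fin n) bs z → Chain (λ i j → Y i j ≡ X i j) a bs z → AltM X v a bs z → AltM Y v a bs z
AltM-cong v a [] z e p = trans e p
AltM-cong v a (b ∷ bs) z (e , c) (p , q) = trans e p , AltM-cong (1ℚ - v) b bs z c q

AltM-cong-∈ : ∀ v (a : Fin n) bs z → (∀ {i j} → i ∈ verts a bs z → j ∈ verts a bs z → Y i j ≡ X i j) →
  AltM X v a bs z → AltM Y v a bs z
AltM-cong-∈ v a bs z e = AltM-cong v a bs z (Chain-map (λ (p , q) → e p q) a bs z (Chain-∈ a bs z))

-- The case `z = a` is allowed: this is how values are written along a cycle.
lay : ℚ → Fin n → List (Fin n) → Fin n → Mat n → Mat n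
lay v a [] z X = set a z v X
lay v a (b ∷ bs) z X = set a b v (lay (1ℚ - v) b bs z X)

1-[1-p]≡p : ∀ p → 1ℚ - (1ℚ - p) ≡ p
1-[1-p]≡p = solve 1 (λ p → con 1ℚ :- (con 1ℚ :- p) := p) refl

lay-elim : (P : Fin n → Fin n → ℚ → Set) → ∀ v a bs z → (∀ i j → P i j v) → (∀ i j → P i j (1ℚ - v)) →
  (∀ i j → P i j (X i j)) → ∀ i j → P i j (lay v a bs z X i j)
lay-elim P v a [] z pv p1-v pX = set-elim P (pv a z) (pv z a) pX
lay-elim P v a (b ∷ bs) z pv p1-v pX = set-elim P (pv a b) (pv b a)
  (lay-elim P (1ℚ - v) b bs z p1-v (λ i j → subst (P i j) (sym (1-[1-p]≡p v)) (pv i j)) pX)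

Pair-∉ : {i j : Fin n} {xs : List (Fin n)} → a ∈ xs → b ∈ xs → i ∉ xs ⊎ j ∉ xs → ¬ Pair a b i j
Pair-∉ a∈ b∈ (inj₁ i∉) (inj₁ (refl , _)) = i∉ a∈
Pair-∉ a∈ b∈ (inj₁ i∉) (inj₂ (refl , _)) = i∉ b∈
Pair-∉ a∈ b∈ (inj₂ j∉) (inj₁ (_ , refl)) = j∉ b∈
Pair-∉ a∈ b∈ (inj₂ j∉) (inj₂ (_ , refl)) = j∉ a∈

lay-miss : ∀ (X : Mat n) v a bs z {i j} → i ∉ verts a bs z ⊎ j ∉ verts a bs z → lay v a bs z X i j ≡ X i j
lay-miss X v a [] z ∉ = set-miss a z v X (Pair-∉ (here refl) (there (here refl)) ∉)
lay-miss X v a (b ∷ bs) z ∉ =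
  trans (set-miss a b v (lay (1ℚ - v) b bs z X) (Pair-∉ (here refl) (there (here refl)) ∉))
        (lay-miss X (1ℚ - v) b bs z (Sum.map (_∘ there) (_∘ there) ∉))

-- The sign with which a discrepancy s at the first vertex of a path shows up at its last vertex.
endSign : ℚ → List (Fin n) → ℚ
endSign s [] = s
endSign s (_ ∷ bs) = endSign (- s) bs

private
  1-v-[1-x] : ∀ v x → (1ℚ - v) - (1ℚ - x) ≡ - (v - x)
  1-v-[1-x] = solve 2 (λ v x → (con 1ℚ :- v) :- (con 1ℚ :- x) := :- (v :- x)) refl

head∉ : {xs : List (Fin n)} → Unique (a ∷ xs) → a ∉ xs
head∉ = Unique.Unique[x∷xs]⇒x∉xs

head≢ : {xs : List (Fin n)} → Unique (a ∷ xs) → b ∈ xs → a ≢ b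
head≢ u p refl = head∉ u p

last∈ : ∀ (bs : List (Fin n)) z → z ∈ bs ++ z ∷ []
last∈ bs z = ∈-++⁺ʳ bs (here refl)

last∉ : ∀ (bs : List (Fin n)) {z} → Unique (bs ++ z ∷ []) → z ∉ bs
last∉ (b ∷ bs) u (here refl) = head∉ u (last∈ bs b)
last∉ (b ∷ bs) (_ ∷ u) (there p) = last∉ bs u p

IsPath : Fin n → List (Fin n) → Fin n → Set
IsPath a bs z = Unique (verts a bs z)

path-Symm : ∀ v (a : Fin n) bs z → IsPath a bs z → Symm X → Symm (lay v a bs z X)
path-Symm v a [] z u sX = set-Symm (head≢ u (here refl)) sX
path-Symm v a (b ∷ bs) z u@(_ ∷ u′) sX = set-Symm (head≢ u (here refl)) (path-Symm (1ℚ - v) b bs z u′ sX)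

path-AltM : ∀ v (a : Fin n) bs z → IsPath a bs z → AltM (lay v a bs z X) v a bs z
path-AltM {X = X} v a [] z u = set-hit a z v X
path-AltM {X = X} v a (b ∷ bs) z u@(_ ∷ u′) =
  set-hit a b v L ,
  AltM-cong-∈ (1ℚ - v) b bs z
    (λ i∈ j∈ → set-miss a b v L λ { (inj₁ (refl , _)) → head∉ u i∈ ; (inj₂ (_ , refl)) → head∉ u j∈ })
    (path-AltM (1ℚ - v) b bs z u′)
  where
  L = lay (1ℚ - v) b bs z X

private
  endpoints : ∀ C s p q r t → C + (- s * q + t * r) + s * (p + q) ≡ C + (s * p + t * r)
  endpoints = solve 6 (λ C s p q r t → C :+ (:- s :* q :+ t :* r) :+ s :* (p :+ q) := C :+ (s :* p :+ t :* r)) refl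

-- The induction step shared by paths and cycles. Writing `v` on the pair `a b` adds `s = v - X a b`
-- at both of its ends. The rest of the path starts with the opposite discrepancy `- s`, so the two
-- cancel at `b`. It is a hypothesis that the rest leaves `a b` unchanged, because paths and cycles
-- have different reasons for it.
step-colsum : ∀ v (a b : Fin n) bs z → a ≢ b → lay (1ℚ - v) b bs z X a b ≡ X a b → Symm (lay (1ℚ - v) b bs z X) →
  (∀ j → colsum (lay (1ℚ - v) b bs z X) j ≡
    colsum X j + (((1ℚ - v) - (1ℚ - X a b)) * ind b j + endSign ((1ℚ - v) - (1ℚ - X a b)) bs * ind z j)) →
  ∀ j → colsum (lay v a (b ∷ bs) z X) j ≡
    colsum X j + ((v - X a b) * ind a j + endSign (v - X a b) (b ∷ bs) * ind z j)
step-colsum {X = X} v a b bs z a≢b same sL rest j = begin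
  colsum (set a b v L) j
    ≡⟨ set-colsum a≢b sL j ⟩
  colsum L j + (v - L a b) * (ind a j + ind b j)
    ≡⟨ cong₂ (λ c e → c + (v - e) * (ind a j + ind b j)) (rest j) same ⟩
  colsum X j + (t * ind b j + endSign t bs * ind z j) + s * (ind a j + ind b j)
    ≡⟨ cong (λ t → colsum X j + (t * ind b j + endSign t bs * ind z j) + s * (ind a j + ind b j)) (1-v-[1-x] v (X a b)) ⟩
  colsum X j + (- s * ind b j + endSign (- s) bs * ind z j) + s * (ind a j + ind b j)
    ≡⟨ endpoints (colsum X j) s (ind a j) (ind b j) (ind z j) (endSign (- s) bs) ⟩
  colsum X j + (s * ind a j + endSign (- s) bs * ind z j) ∎
  where
  L = lay (1ℚ - v) b bs z X
  s = v - X a b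
  t = (1ℚ - v) - (1ℚ - X a b)

-- The discrepancy between two alternating sequences changes sign from each pair to the next, so
-- only the two ends of the path notice it.
path-colsum : ∀ v x (a : Fin n) bs z → IsPath a bs z → Symm X → AltM X x a bs z → ∀ j →
  colsum (lay v a bs z X) j ≡ colsum X j + ((v - x) * ind a j + endSign (v - x) bs * ind z j)
path-colsum {X = X} v x a [] z u sX refl j =
  trans (set-colsum (head≢ u (here refl)) sX j)
        (cong (colsum X j +_) (*-distribˡ-+ (v - x) (ind a j) (ind z j)))
path-colsum {X = X} v x a (b ∷ bs) z u@(_ ∷ u′) sX (refl , alt) =
  step-colsum v a b bs z (head≢ u (here refl)) (lay-miss X (1ℚ - v) b bs z (inj₁ (head∉ u)))
    (path-Symm (1ℚ - v) b bs z u′ sX) (path-colsum (1ℚ - v) (1ℚ - X a b) b bs z u′ sX alt)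

-- The cycle a, b, c, cs, back to a.
IsCycle : Fin n → Fin n → Fin n → List (Fin n) → Set
IsCycle a b c cs = IsPath b (c ∷ cs) a

module _ (a b c : Fin n) (cs : List (Fin n)) (u : IsCycle a b c cs) where

  private
    u′ : Unique (verts c cs a)
    u′ = AllPairs.tail u

    b≢a : b ≢ a
    b≢a = head≢ u (last∈ (c ∷ cs) a)

    a≢b : a ≢ b
    a≢b = b≢a ∘ sym

    ∉-interior : a ∉ c ∷ cs × b ∉ c ∷ cs
    ∉-interior = last∉ (c ∷ cs) u′ , λ p → head∉ u (∈-++⁺ˡ p)

    interior-miss : {i j : Fin n} → i ∈ c ∷ cs ⊎ j ∈ c ∷ cs → ¬ Pair a b i j
    interior-miss (inj₁ i∈) (inj₁ (refl , _)) = proj₁ ∉-interior i∈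
    interior-miss (inj₁ i∈) (inj₂ (refl , _)) = proj₂ ∉-interior i∈
    interior-miss (inj₂ j∈) (inj₁ (_ , refl)) = proj₂ ∉-interior j∈
    interior-miss (inj₂ j∈) (inj₂ (_ , refl)) = proj₁ ∉-interior j∈

  cycle-Symm : ∀ v → Symm X → Symm (lay v a (b ∷ c ∷ cs) a X)
  cycle-Symm v sX = set-Symm a≢b (path-Symm (1ℚ - v) b (c ∷ cs) a u sX)

  cycle-AltM : ∀ v → AltM (lay v a (b ∷ c ∷ cs) a X) v a (b ∷ c ∷ cs) a
  cycle-AltM {X = X} v =
    set-hit a b v L ,
    AltM-cong (1ℚ - v) b (c ∷ cs) a
      (Chain-map (λ p → set-miss a b v L (interior-miss p)) b (c ∷ cs) a (Chain-interior b c cs a))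
      (path-AltM (1ℚ - v) b (c ∷ cs) a u)
    where
    L = lay (1ℚ - v) b (c ∷ cs) a X

  -- Both ends of the closed path are `a`. Their contributions cancel if the cycle is even and add
  -- up to `2(v - x)` if it is odd.
  cycle-colsum : ∀ v x → Symm X → AltM X x a (b ∷ c ∷ cs) a → ∀ j →
    colsum (lay v a (b ∷ c ∷ cs) a X) j ≡
    colsum X j + ((v - x) * ind a j + endSign (v - x) (b ∷ c ∷ cs) * ind a j)
  cycle-colsum {X = X} v x sX (refl , alt) =
    step-colsum v a b (c ∷ cs) a a≢b
      -- The vertex `a` does lie on the remaining path, as its end. The pair `a b` is still
      -- untouched: it differs from `b c`, and all later pairs avoid `b`.
      (trans (set-miss b c (1ℚ - v) (lay (1ℚ - (1ℚ - v)) c cs a X)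
               λ { (inj₁ (p , _)) → a≢b p ; (inj₂ (p , _)) → head≢ u′ (last∈ cs a) (sym p) })
             (lay-miss X (1ℚ - (1ℚ - v)) c cs a (inj₂ (head∉ u))))
      (path-Symm (1ℚ - v) b (c ∷ cs) a u sX)
      (path-colsum (1ℚ - v) (1ℚ - X a b) b (c ∷ cs) a u sX alt)

-- Steps of two match the period of an alternating path. The cycle `a`, `b`, `c`, `cs` is odd
-- exactly when `cs` has even length.
data EvenLength {A : Set} : List A → Set where
  even-[] : EvenLength []
  even-∷∷ : ∀ {x y xs} → EvenLength xs → EvenLength (x ∷ y ∷ xs)

evenLength⊎ : {A : Set} (x : A) (xs : List A) → EvenLength xs ⊎ EvenLength (x ∷ xs)
evenLength⊎ x [] = inj₁ even-[]
evenLength⊎ x (y ∷ xs) with evenLength⊎ y xs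
... | inj₁ e = inj₂ (even-∷∷ e)
... | inj₂ e = inj₁ e

endSign-even : ∀ s {bs : List (Fin n)} → EvenLength bs → endSign s bs ≡ s
endSign-even s even-[] = refl
endSign-even s (even-∷∷ e) = trans (endSign-even (- (- s)) e) (⁻¹-involutive s)

lastVertex : Fin n → List (Fin n) → Fin n
lastVertex a [] = a
lastVertex a (b ∷ bs) = lastVertex b bs

lastVertex∈ : ∀ (a : Fin n) bs → lastVertex a bs ∈ a ∷ bs
lastVertex∈ a [] = here refl
lastVertex∈ a (b ∷ bs) = there (lastVertex∈ b bs)

-- An even number of interior vertices means an odd number of pairs. Hence on an odd cycle the first
-- and last pairs, which meet at the base point, have the same value.
AltM-last : ∀ x {bs} → EvenLength bs → AltM X x a bs z → X (lastVertex a bs) z ≡ x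
AltM-last x even-[] alt = alt
AltM-last {X = X} {z = z} x (even-∷∷ {y = c} e) (_ , _ , alt) =
  AltM-last x e (subst (λ y → AltM X y c _ z) (1-[1-p]≡p x) alt)

-- Graphs and points of the polytope as matrices

sumℚ-allFin : (f : Fin n → ℚ) → sumℚ (map f (allFin n)) ≡ sum f
sumℚ-allFin f = trans (cong sumℚ (map-tabulate id f)) (go f)
  where
  go : ∀ {n} (f : Fin n → ℚ) → sumℚ (tabulate f) ≡ sum f
  go {zero} f = refl
  go {suc n} f = cong (f zero +_) (go (f ∘ suc))

ι-sum-allFin : (f : Fin n → ℕ) → ι (ℤ.+ ℕ.sum (map f (allFin n))) ≡ sum (λ i → ι (ℤ.+ f i))
ι-sum-allFin f = trans (cong (λ xs → ι (ℤ.+ ℕ.sum xs)) (map-tabulate id f)) (go f)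
  where
  go : ∀ {n} (f : Fin n → ℕ) → ι (ℤ.+ ℕ.sum (tabulate f)) ≡ sum (λ i → ι (ℤ.+ f i))
  go {zero} f = refl
  go {suc n} f = trans (ι-+ (ℤ.+ f zero) (ℤ.+ ℕ.sum (tabulate (f ∘ suc)))) (cong (ι (ℤ.+ f zero) +_) (go (f ∘ suc)))

pairVal-< : (x : Point n) {i j : Fin n} → i Fin.< j → pairVal x i j ≡ x i j
pairVal-< x {i} {j} i<j with i <? j
... | yes _ = refl
... | no i≮j = contradiction i<j i≮j

pairVal-> : (x : Point n) {i j : Fin n} → j Fin.< i → pairVal x i j ≡ x j i
pairVal-> x {i} {j} j<i with i <? j
... | yes i<j = contradiction i<j (Fin.<-asym j<i)
... | no _ with j <? i
...   | yes _ = refl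
...   | no j≮i = contradiction j<i j≮i

pairVal-Symm : (x : Point n) → Symm (pairVal x)
pairVal-Symm x .comm i j with <-cmp i j
... | tri< i<j _ _ = trans (pairVal-< x i<j) (sym (pairVal-> x i<j))
... | tri≈ _ refl _ = refl
... | tri> _ _ j<i = trans (pairVal-> x j<i) (sym (pairVal-< x j<i))
pairVal-Symm x .diag i with i <? i
... | yes i<i = contradiction i<i (Fin.<-irrefl refl)
... | no i≮i with i <? i
...   | yes i<i = contradiction i<i i≮i
...   | no _ = refl

Symm-ext : Symm X → Symm Y → (∀ i j → i Fin.< j → X i j ≡ Y i j) → ∀ i j → X i j ≡ Y i j
Symm-ext sX sY eq i j with <-cmp i j
... | tri< i<j _ _ = eq i j i<j
... | tri≈ _ refl _ = trans (sX .diag i) (sym (sY .diag i))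
... | tri> _ _ j<i = trans (sX .comm i j) (trans (eq j i j<i) (sY .comm j i))

pairVal-id : Symm X → ∀ i j → pairVal X i j ≡ X i j
pairVal-id {X = X} sX = Symm-ext (pairVal-Symm X) sX λ i j → pairVal-< X

Is01 : ℚ → Set
Is01 q = q ≡ 0ℚ ⊎ q ≡ 1ℚ

Is01-1- : ∀ {q} → Is01 q → Is01 (1ℚ - q)
Is01-1- (inj₁ refl) = inj₂ refl
Is01-1- (inj₂ refl) = inj₁ refl

Is01⇒IsInt : ∀ {q} → Is01 q → IsInt q
Is01⇒IsInt (inj₁ refl) = IsInt-0
Is01⇒IsInt (inj₂ refl) = IsInt-1

Is01⇒bounds : ∀ {q} → Is01 q → 0ℚ ≤ q × q ≤ 1ℚ
Is01⇒bounds (inj₁ refl) = ≤-refl , *≤* (ℤ.+≤+ ℕ.z≤n)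
Is01⇒bounds (inj₂ refl) = *≤* (ℤ.+≤+ ℕ.z≤n) , ≤-refl

Is01-cases : ∀ {p q} → Is01 p → Is01 q → p ≡ q ⊎ p ≡ 1ℚ - q
Is01-cases (inj₁ refl) (inj₁ refl) = inj₁ refl
Is01-cases (inj₁ refl) (inj₂ refl) = inj₂ refl
Is01-cases (inj₂ refl) (inj₁ refl) = inj₂ refl
Is01-cases (inj₂ refl) (inj₂ refl) = inj₁ refl

record Realization (X : Mat n) (d : Fin n → ℕ) : Set where
  field
    symm : Symm X
    is01 : ∀ i j → Is01 (X i j)
    degrees : ∀ j → colsum X j ≡ ι (ℤ.+ d j)
open Realization public

bool : Bool → ℚ
bool b = if b then 1ℚ else 0ℚ

bool-01 : ∀ b → Is01 (bool b)
bool-01 false = inj₁ refl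
bool-01 true = inj₂ refl

bool-≢ : ∀ {x y} → x ≢ y → bool y ≡ 1ℚ - bool x
bool-≢ {false} {false} x≢y = contradiction refl x≢y
bool-≢ {false} {true} x≢y = refl
bool-≢ {true} {false} x≢y = refl
bool-≢ {true} {true} x≢y = contradiction refl x≢y

bool-1- : ∀ {x y} → bool y ≡ 1ℚ - bool x → x ≢ y
bool-1- {false} () refl
bool-1- {true} () refl

matrix : Graph n → Mat n
matrix G i j = bool (adj G i j)

ι-bool : ∀ b → ι (ℤ.+ (if b then 1 else 0)) ≡ bool b
ι-bool false = refl
ι-bool true = refl

matrix-colsum : (G : Graph n) → ∀ j → colsum (matrix G) j ≡ ι (ℤ.+ degree G j)
matrix-colsum G j = begin
  sum (λ i → bool (adj G i j))                        ≡⟨ sum-cong-≗ (λ i → cong bool (adj-sym G i j)) ⟩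
  sum (λ i → bool (adj G j i))                        ≡⟨ sum-cong-≗ (λ i → sym (ι-bool (adj G j i))) ⟩
  sum (λ i → ι (ℤ.+ (if adj G j i then 1 else 0)))    ≡⟨ sym (ι-sum-allFin (λ i → if adj G j i then 1 else 0)) ⟩
  ι (ℤ.+ degree G j)                                  ∎

matrix-Symm : (G : Graph n) → Symm (matrix G)
matrix-Symm G .comm i j = cong bool (adj-sym G i j)
matrix-Symm G .diag i = cong bool (irrefl G i)

matrix-Realization : (G : Graph n) {d : Fin n → ℕ} → Realizes G d → Realization (matrix G) d
matrix-Realization G real .symm = matrix-Symm G
matrix-Realization G real .is01 i j = bool-01 (adj G i j)
matrix-Realization G real .degrees j = trans (matrix-colsum G j) (cong (λ k → ι (ℤ.+ k)) (real j))

module _ (sX : Symm X) (01X : ∀ i j → Is01 (X i j)) where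

  toGraph : Σ (Graph _) λ G → ∀ i j → matrix G i j ≡ X i j
  toGraph = G , λ i j → bool-does (01X i j)
    where
    one? : ∀ q → Dec (q ≡ 1ℚ)
    one? q = q ℚ.≟ 1ℚ
    bool-does : ∀ {q} → Is01 q → bool (does (one? q)) ≡ q
    bool-does (inj₁ refl) = refl
    bool-does (inj₂ refl) = refl
    G : Graph _
    G .adj i j = does (one? (X i j))
    G .adj-sym i j = cong (does ∘ one?) (sX .comm i j)
    G .irrefl i = cong (does ∘ one?) (sX .diag i)

graph-degree : (G : Graph n) {d : Fin n → ℕ} → (∀ i j → matrix G i j ≡ X i j) →
  (∀ j → colsum X j ≡ ι (ℤ.+ d j)) → Realizes G d
graph-degree G eq deg j = ℤ.+-injective (ι-injective
  (trans (sym (matrix-colsum G j)) (trans (sum-cong-≗ λ i → eq i j) (deg j))))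

-- The first part has an odd number of pairs and ends with the value `x`, so the second must begin
-- with `1 - x`.
AltM-join : ∀ {x} {bs} (y : Fin n) (cs : List (Fin n)) → EvenLength bs →
  AltM X x a bs y → AltM X (1ℚ - x) y cs z → AltM X x a (bs ++ y ∷ cs) z
AltM-join y cs even-[] p q = p , q
AltM-join {X = X} {z = z} {x} y cs (even-∷∷ {y = c} e) (p , q , r) s =
  p , q , AltM-join y cs e r (subst (λ x → AltM X x y cs z) (cong (λ p → 1ℚ - p) (sym (1-[1-p]≡p x))) s)

AltM-split : ∀ {x} {bs} (y : Fin n) (cs : List (Fin n)) → EvenLength bs →
  AltM X x a (bs ++ y ∷ cs) z → AltM X x a bs y × AltM X (1ℚ - x) y cs z
AltM-split y cs even-[] (p , q) = p , q
AltM-split {X = X} {z = z} {x} y cs (even-∷∷ {y = c} e) (p , q , r) with AltM-split y cs e r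
... | s , t = (p , q , s) , subst (λ x → AltM X x y cs z) (cong (λ p → 1ℚ - p) (1-[1-p]≡p x)) t

Alternating⇒AltM : (G : Graph n) → ∀ a b bs z → Alternating G (verts a (b ∷ bs) z) → AltM (matrix G) (matrix G a b) a (b ∷ bs) z
Alternating⇒AltM G a b [] z (p , _) = refl , bool-≢ p
Alternating⇒AltM G a b (c ∷ bs) z (p , alt) =
  refl , subst (λ x → AltM (matrix G) x b (c ∷ bs) z) (bool-≢ p) (Alternating⇒AltM G b c bs z alt)

AltM⇒Alternating : (G : Graph n) → ∀ {x} a b bs z → AltM (matrix G) x a (b ∷ bs) z → Alternating G (verts a (b ∷ bs) z)
AltM⇒Alternating G a b [] z (p , q) = bool-1- (trans q (cong (λ p → 1ℚ - p) (sym p))) , _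
AltM⇒Alternating G a b (c ∷ bs) z (p , alt@(q , _)) =
  bool-1- (trans q (cong (λ p → 1ℚ - p) (sym p))) , AltM⇒Alternating G b c bs z alt

-- Shrinking blossoms to triangles

verts-closed : ∀ (a : Fin n) bs {i} → i ∈ verts a bs a → i ∈ a ∷ bs
verts-closed a bs (here p) = here p
verts-closed a bs (there p) with ∈-++⁻ bs p
... | inj₁ q = there q
... | inj₂ (here q) = here q

-- A matrix in place of a graph allows exchanges along cycles by `lay`. The cycle condition is
-- recorded for the first cycle only, the one that is shortened; the second is carried along, and
-- its condition is kept outside the record.
record Blossom (X : Mat n) (d : Fin n → ℕ) (x : ℚ) (a b c : Fin n) (cs : List (Fin n)) (p : Fin n) (ps : List (Fin n)) : Set where
  field
    real : Realization X d
    cycle : IsCycle a b c cs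
    alt₁ : AltM X x a (b ∷ c ∷ cs) a
    alt₂ : AltM X x p ps p
    link : X a p ≡ 1ℚ - x
    disjoint : ∀ {i} → i ∈ a ∷ b ∷ c ∷ cs → i ∉ p ∷ ps
open Blossom public

-- Makes `shrink`, which acts on the first cycle, available for the second.
Blossom-swap : ∀ {d : Fin n → ℕ} {x a b c cs p q r rs} → Blossom X d x a b c cs p (q ∷ r ∷ rs) → IsCycle p q r rs →
  Blossom X d x p q r rs a (b ∷ c ∷ cs)
Blossom-swap B u = record
  { real = real B ; cycle = u ; alt₁ = alt₂ B ; alt₂ = alt₁ B
  ; link = trans (real B .symm .comm _ _) (link B) ; disjoint = λ p q → disjoint B q p }

-- With x the value of the first edge ab of the cycle a, b, c, d, e, …: if the chord ad has value x as well,
-- then a, d, e, … is a shorter alternating cycle; otherwise the 4-cycle a, b, c, d alternates,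
-- and exchanging its values changes no degree and gives ad the value x.
shrink : ∀ {d : Fin n → ℕ} {x a b c cs p ps} → EvenLength cs → Blossom X d x a b c cs p ps →
  ∃ λ X′ → ∃ λ b′ → ∃ λ c′ → Blossom X′ d x a b′ c′ [] p ps
shrink even-[] B = _ , _ , _ , B
shrink {X = X} {d = δ} {x} {a} {b} {c} {_} {p} {ps} (even-∷∷ {d} {e} {cs} ev) B
  with u@(_ ∷ u′@(_ ∷ u″@(_ ∷ u‴))) ← cycle B
  with ab , bc , cd , rest ← alt₁ B
  with Is01-cases (real B .is01 a d) (real B .is01 a b)
... | inj₁ ad≡ab = shrink ev record
  { real = real B ; cycle = u″
  ; alt₁ = trans ad≡ab ab , subst (λ y → AltM X y d (e ∷ cs) a) (cong (λ p → 1ℚ - p) (1-[1-p]≡p x)) rest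
  ; alt₂ = alt₂ B ; link = link B ; disjoint = disjoint B ∘ drop-bc }
  where
  drop-bc : ∀ {i} → i ∈ a ∷ d ∷ e ∷ cs → i ∈ a ∷ b ∷ c ∷ d ∷ e ∷ cs
  drop-bc (here q) = here q
  drop-bc (there q) = there (there (there q))
... | inj₂ ad≡1-ab = shrink ev record
  { real = record
      { symm = cycle-Symm a b c (d ∷ []) v (1ℚ - x) (real B .symm)
      ; is01 = lay-elim (λ _ _ → Is01) (1ℚ - x) a (b ∷ c ∷ d ∷ []) a
          (λ _ _ → Is01-1- 01x) (λ _ _ → Is01-1- (Is01-1- 01x)) (real B .is01)
      ; degrees = λ j → trans (cycle-colsum a b c (d ∷ []) v (1ℚ - x) x (real B .symm) (ab , bc , cd , da) j)
          (trans (cancel (colsum X j) ((1ℚ - x) - x) (ind a j)) (real B .degrees j)) }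
  ; cycle = u″
  ; alt₁ = trans (L-symm .comm a d) (trans L-da (trans (1-[1-p]≡p (1ℚ - (1ℚ - x))) (1-[1-p]≡p x))) ,
      -- Every pair of the path from `d` through `e` back to `a` meets `e ∷ cs`, which is disjoint
      -- from the 4-cycle, so the exchange leaves its values alone.
      AltM-cong {X = X} (1ℚ - x) d (e ∷ cs) a
        (Chain-map (λ m → lay-miss X (1ℚ - x) a (b ∷ c ∷ d ∷ []) a (Sum.map interior∉ interior∉ m)) d (e ∷ cs) a
          (Chain-interior d e cs a))
        (subst (λ y → AltM X y d (e ∷ cs) a) (cong (λ p → 1ℚ - p) (1-[1-p]≡p x)) rest)
  ; alt₂ = AltM-cong-∈ {X = X} x p ps p
      (λ i∈ _ → lay-miss X (1ℚ - x) a (b ∷ c ∷ d ∷ []) a (inj₁ (outside∉ (verts-closed p ps i∈)))) (alt₂ B)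
  ; link = trans (lay-miss X (1ℚ - x) a (b ∷ c ∷ d ∷ []) a (inj₂ (outside∉ (here refl)))) (link B)
  ; disjoint = disjoint B ∘ drop-bc }
  where
  drop-bc : ∀ {i} → i ∈ a ∷ d ∷ e ∷ cs → i ∈ a ∷ b ∷ c ∷ d ∷ e ∷ cs
  drop-bc (here q) = here q
  drop-bc (there q) = there (there (there q))
  01x : Is01 x
  01x = subst Is01 ab (real B .is01 a b)
  v : IsCycle a b c (d ∷ [])
  v = (head≢ u (here refl) ∷ head≢ u (there (here refl)) ∷ head≢ u (last∈ (c ∷ d ∷ e ∷ cs) a) ∷ [])
    ∷ (head≢ u′ (here refl) ∷ head≢ u′ (last∈ (d ∷ e ∷ cs) a) ∷ [])
    ∷ (head≢ u″ (last∈ (e ∷ cs) a) ∷ []) ∷ [] ∷ []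
  L : Mat _
  L = lay (1ℚ - x) a (b ∷ c ∷ d ∷ []) a X
  L-symm : Symm L
  L-symm = cycle-Symm a b c (d ∷ []) v (1ℚ - x) (real B .symm)
  L-da : L d a ≡ 1ℚ - (1ℚ - (1ℚ - (1ℚ - x)))
  L-da = cycle-AltM a b c (d ∷ []) v {X = X} (1ℚ - x) .proj₂ .proj₂ .proj₂
  da : X d a ≡ 1ℚ - (1ℚ - (1ℚ - x))
  da = trans (real B .symm .comm d a) (trans ad≡1-ab
    (trans (cong (λ p → 1ℚ - p) ab) (sym (1-[1-p]≡p (1ℚ - x)))))
  -- The 4-cycle is even: its second contribution at `a` carries three sign changes and cancels the
  -- first.
  cancel : ∀ C s y → C + (s * y + - (- (- s)) * y) ≡ C
  cancel = solve 3 (λ C s y → C :+ (s :* y :+ :- (:- (:- s)) :* y) := C) refl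
  interior∉ : ∀ {i} → i ∈ e ∷ cs → i ∉ verts a (b ∷ c ∷ d ∷ []) a
  interior∉ i∈ (here refl) = last∉ (e ∷ cs) u‴ i∈
  interior∉ i∈ (there (here refl)) = head∉ u (there (there (∈-++⁺ˡ i∈)))
  interior∉ i∈ (there (there (here refl))) = head∉ u′ (there (∈-++⁺ˡ i∈))
  interior∉ i∈ (there (there (there (here refl)))) = head∉ u″ (∈-++⁺ˡ i∈)
  interior∉ i∈ (there (there (there (there (here refl))))) = last∉ (e ∷ cs) u‴ i∈
  outside∉ : ∀ {i} → i ∈ p ∷ ps → i ∉ verts a (b ∷ c ∷ d ∷ []) a
  outside∉ i∈ (here refl) = disjoint B (here refl) i∈
  outside∉ i∈ (there (here refl)) = disjoint B (there (here refl)) i∈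
  outside∉ i∈ (there (there (here refl))) = disjoint B (there (there (here refl))) i∈
  outside∉ i∈ (there (there (there (here refl)))) = disjoint B (there (there (there (here refl)))) i∈
  outside∉ i∈ (there (there (there (there (here refl))))) = disjoint B (here refl) i∈

Unique-∷ : {xs : List (Fin n)} → a ∉ xs → Unique xs → Unique (a ∷ xs)
Unique-∷ a∉ u = All.tabulate (λ { i∈ refl → a∉ i∈ }) ∷ u

Unique-++⁻ : ∀ (xs : List (Fin n)) {ys} → Unique (xs ++ ys) →
  Unique xs × Unique ys × (∀ {i} → i ∈ xs → i ∉ ys)
Unique-++⁻ [] u = [] , u , λ ()
Unique-++⁻ (x ∷ xs) (x∉ ∷ u) with Unique-++⁻ xs u
... | ux , uy , disj = All.++⁻ˡ xs x∉ ∷ ux , uy , λ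
  { (here refl) i∈ → All.lookup (All.++⁻ʳ xs x∉) i∈ refl
  ; (there i∈) → disj i∈ }

Unique-rotate : ∀ {a : Fin n} {xs} → Unique (a ∷ xs) → Unique (xs ++ a ∷ [])
Unique-rotate u@(_ ∷ u′) = Unique.++⁺ u′ ([] ∷ []) λ { (i∈ , here refl) → head∉ u i∈ }

Unique-rotate⁻ : ∀ {a : Fin n} xs → Unique (xs ++ a ∷ []) → Unique (a ∷ xs)
Unique-rotate⁻ xs u = Unique-∷ (last∉ xs u) (Unique-++⁻ xs u .proj₁)

evenLength : {A : Set} → ∀ m (xs : List A) → length xs ≡ 2 ℕ.* m → EvenLength xs
evenLength zero [] _ = even-[]
evenLength (suc m) [] eq = contradiction (trans eq (ℕ.*-suc 2 m)) λ ()
evenLength (suc m) (x ∷ []) eq = contradiction (trans eq (ℕ.*-suc 2 m)) λ ()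
evenLength (suc m) (x ∷ y ∷ xs) eq =
  even-∷∷ (evenLength m xs (ℕ.suc-injective (ℕ.suc-injective (trans eq (ℕ.*-suc 2 m)))))

data HasBlossom (X : Mat n) (d : Fin n → ℕ) : Set where
  hasBlossom : ∀ {x a b c cs p q r rs} → EvenLength cs → EvenLength rs → IsCycle p q r rs →
    Blossom X d x a b c cs p (q ∷ r ∷ rs) → HasBlossom X d

-- The walk is cut at its second visit to `a`. An odd cycle ends with the value `x` with which it
-- starts, so the linking pair has value `1 - x` and the second cycle starts with `x` again.
IntegralBlossom⇒HasBlossom : (G : Graph n) {d : Fin n → ℕ} → Realizes G d → ∀ k l →
  Odd k → 3 ℕ.≤ k → Odd l → 3 ℕ.≤ l → IntegralBlossom G k l → HasBlossom (matrix G) d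
IntegralBlossom⇒HasBlossom {n} G {d} real _ _ (i , odd₁) (ℕ.s≤s (ℕ.s≤s (ℕ.s≤s _))) (j , odd₂) (ℕ.s≤s (ℕ.s≤s (ℕ.s≤s _)))
  (a ∷ b ∷ c ∷ cs , p ∷ q ∷ r ∷ rs , refl , refl , u , alt) =
  go (evenLength i (b ∷ c ∷ cs) (ℕ.suc-injective odd₁)) (evenLength j (q ∷ r ∷ rs) (ℕ.suc-injective odd₂))
  where
  walk : AltM (matrix G) (matrix G a b) a (b ∷ c ∷ cs ++ a ∷ p ∷ q ∷ r ∷ rs) p
  walk = Alternating⇒AltM G a b (c ∷ cs ++ a ∷ p ∷ q ∷ r ∷ rs) p
    (subst (λ ys → Alternating G (a ∷ b ∷ c ∷ ys)) (sym (++-assoc cs (a ∷ p ∷ q ∷ r ∷ rs) (p ∷ []))) alt)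
  unique : Unique (a ∷ b ∷ c ∷ cs) × Unique (p ∷ q ∷ r ∷ rs) × (∀ {i} → i ∈ a ∷ b ∷ c ∷ cs → i ∉ p ∷ q ∷ r ∷ rs)
  unique = Unique-++⁻ (a ∷ b ∷ c ∷ cs) u
  go : EvenLength (b ∷ c ∷ cs) → EvenLength (q ∷ r ∷ rs) → HasBlossom (matrix G) d
  go even@(even-∷∷ even₁) (even-∷∷ even₂) =
    hasBlossom even₁ even₂ (Unique-rotate (unique .proj₂ .proj₁)) record
      { real = matrix-Realization G real
      ; cycle = Unique-rotate (unique .proj₁)
      ; alt₁ = split .proj₁
      ; alt₂ = subst (λ y → AltM (matrix G) y p (q ∷ r ∷ rs) p) (1-[1-p]≡p (matrix G a b)) (split .proj₂ .proj₂)
      ; link = split .proj₂ .proj₁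
      ; disjoint = unique .proj₂ .proj₂ }
    where
    split : AltM (matrix G) (matrix G a b) a (b ∷ c ∷ cs) a × AltM (matrix G) (1ℚ - matrix G a b) a (p ∷ q ∷ r ∷ rs) p
    split = AltM-split {X = matrix G} a (p ∷ q ∷ r ∷ rs) even walk

triangles-walk : ∀ {x a b c p q r} (G : Graph n) → (∀ i j → matrix G i j ≡ X i j) →
  AltM X x a (b ∷ c ∷ []) a → X a p ≡ 1ℚ - x → AltM X x p (q ∷ r ∷ []) p →
  Alternating G (blossomWalk (a ∷ b ∷ c ∷ []) (p ∷ q ∷ r ∷ []))
triangles-walk {X = X} {x} {a} {b} {c} {p} {q} {r} G eq alt₁ link alt₂ =
  AltM⇒Alternating G {x} a b (c ∷ a ∷ p ∷ q ∷ r ∷ []) p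
    (AltM-cong-∈ {X = X} x a (b ∷ c ∷ a ∷ p ∷ q ∷ r ∷ []) p (λ {i} {j} _ _ → eq i j) walk)
  where
  walk : AltM X x a (b ∷ c ∷ a ∷ p ∷ q ∷ r ∷ []) p
  walk = AltM-join {X = X} {bs = b ∷ c ∷ []} a (p ∷ q ∷ r ∷ []) (even-∷∷ even-[]) alt₁
    (link , subst (λ y → AltM X y p (q ∷ r ∷ []) p) (sym (1-[1-p]≡p x)) alt₂)

Blossom⇒IntegralBlossom : ∀ {d : Fin n → ℕ} {x a b c p q r} → IsCycle p q r [] → Blossom X d x a b c [] p (q ∷ r ∷ []) →
  Σ (Graph n) λ G → Realizes G d × IntegralBlossom G 3 3
Blossom⇒IntegralBlossom {n} {X = X} {d} {x} {a} {b} {c} {p} {q} {r} u B = go (toGraph (real B .symm) (real B .is01))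
  where
  go : (Σ (Graph n) λ G → ∀ i j → matrix G i j ≡ X i j) → Σ (Graph n) λ G → Realizes G d × IntegralBlossom G 3 3
  go (G , eq) = G , graph-degree G eq (real B .degrees) ,
    (a ∷ b ∷ c ∷ [] , p ∷ q ∷ r ∷ [] , refl , refl ,
     Unique.++⁺ (Unique-rotate⁻ (b ∷ c ∷ []) (cycle B)) (Unique-rotate⁻ (q ∷ r ∷ []) u)
       (λ (i∈ , j∈) → disjoint B i∈ j∈) ,
     triangles-walk G eq (alt₁ B) (link B) (alt₂ B))

data TriangleBlossom (d : Fin n → ℕ) : Set where
  triangles : ∀ {X x a b c p q r} → IsCycle p q r [] → Blossom X d x a b c [] p (q ∷ r ∷ []) → TriangleBlossom d

HasBlossom⇒TriangleBlossom : {d : Fin n → ℕ} → HasBlossom X d → TriangleBlossom d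
HasBlossom⇒TriangleBlossom {n} {d = d} (hasBlossom {x} {a} {p = p} {q} {r} {rs} even₁ even₂ u B) = step₁ (shrink even₁ B)
  where
  step₂ : ∀ {b c} → IsCycle a b c [] →
    (∃ λ X → ∃ λ q → ∃ λ r → Blossom X d x p q r [] a (b ∷ c ∷ [])) → TriangleBlossom d
  step₂ v (_ , _ , _ , B₂) = triangles v B₂
  step₁ : (∃ λ X → ∃ λ b → ∃ λ c → Blossom X d x a b c [] p (q ∷ r ∷ rs)) → TriangleBlossom d
  step₁ (_ , _ , _ , B₁) = step₂ (cycle B₁) (shrink even₂ (Blossom-swap B₁ u))

HasBlossom⇒¬33 : {d : Fin n → ℕ} → HasBlossom X d → ¬ NoBlossoms33 d
HasBlossom⇒¬33 H none = go (HasBlossom⇒TriangleBlossom H)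
  where
  go : TriangleBlossom _ → ⊥
  go (triangles v B) = let G , realizes , blossom = Blossom⇒IntegralBlossom v B in none G realizes blossom

33⇒NoBlossoms : {d : Fin n → ℕ} → NoBlossoms33 d → NoBlossoms d
33⇒NoBlossoms none G real k l odd-k 3≤k odd-l 3≤l blossom =
  HasBlossom⇒¬33 (IntegralBlossom⇒HasBlossom G real k l odd-k 3≤k odd-l 3≤l blossom) none

NoBlossoms⇒33 : {d : Fin n → ℕ} → NoBlossoms d → NoBlossoms33 d
NoBlossoms⇒33 none G real = none G real 3 3 (1 , refl) ℕ.≤-refl (1 , refl) ℕ.≤-refl

-- Linear systems with more unknowns than equations

sum² : Mat n → ℚ
sum² f = sum (λ i → sum (f i))

sum²-linear : ∀ p q (f g : Mat n) → sum² (λ i j → p * f i j + q * g i j) ≡ p * sum² f + q * sum² g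
sum²-linear p q f g = begin
  sum (λ i → sum (λ j → p * f i j + q * g i j))     ≡⟨ sum-cong-≗ (λ i → linear (f i) (g i)) ⟩
  sum (λ i → p * sum (f i) + q * sum (g i))         ≡⟨ linear (λ i → sum (f i)) (λ i → sum (g i)) ⟩
  p * sum² f + q * sum² g                           ∎
  where
  linear : ∀ {n} (f g : Fin n → ℚ) → sum (λ i → p * f i + q * g i) ≡ p * sum f + q * sum g
  linear f g = trans (∑-distrib-+ (λ i → p * f i) (λ i → q * g i))
    (sym (cong₂ _+_ (*-distribˡ-sum p f) (*-distribˡ-sum q g)))

sum²-cong : {f g : Mat n} → (∀ i j → f i j ≡ g i j) → sum² f ≡ sum² g
sum²-cong eq = sum-cong-≗ λ i → sum-cong-≗ (eq i)

sum²-zero : (f : Mat n) → (∀ i j → f i j ≡ 0ℚ) → sum² f ≡ 0ℚ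
sum²-zero f f≡0 = sum-zero _ λ i → sum-zero (f i) (f≡0 i)

unit : Fin n → Fin n → Mat n
unit a b i j = ind a i * ind b j

sum²-unit : (f : Mat n) (a b : Fin n) → sum² (λ i j → f i j * unit a b i j) ≡ f a b
sum²-unit f a b = begin
  sum² (λ i j → f i j * (ind a i * ind b j))
    ≡⟨ sum²-cong (λ i j → solve 3 (λ f p q → f :* (p :* q) := p :* (q :* f)) refl (f i j) (ind a i) (ind b j)) ⟩
  sum (λ i → sum (λ j → ind a i * (ind b j * f i j)))
    ≡⟨ sum-cong-≗ (λ i → sym (*-distribˡ-sum (ind a i) (λ j → ind b j * f i j))) ⟩
  sum (λ i → ind a i * sum (λ j → ind b j * f i j))
    ≡⟨ sum-ind-* a (λ i → sum (λ j → ind b j * f i j)) ⟩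
  sum (λ j → ind b j * f a j)
    ≡⟨ sum-ind-* b (f a) ⟩
  f a b ∎

⟪_,_⟫ : Mat n → Mat n → ℚ
⟪ r , v ⟫ = sum² (λ i j → r i j * v i j)

⟪,⟫-zero : (r v : Mat n) → (∀ i j → r i j ≡ 0ℚ ⊎ v i j ≡ 0ℚ) → ⟪ r , v ⟫ ≡ 0ℚ
⟪,⟫-zero r v rv≡0 = sum²-zero _ λ i j → [ (λ eq → trans (cong (_* v i j) eq) (*-zeroˡ (v i j))) , (λ eq → trans (cong (r i j *_) eq) (*-zeroʳ (r i j))) ]′ (rv≡0 i j)

*-cancel-≢0 : ∀ {p q} → p ≢ 0ℚ → p * q ≡ 0ℚ → q ≡ 0ℚ
*-cancel-≢0 {p} {q} p≢0 pq≡0 = begin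
  q                 ≡⟨ sym (*-identityˡ q) ⟩
  1ℚ * q            ≡⟨ cong (_* q) (sym (*-inverseˡ p)) ⟩
  (1/ p * p) * q    ≡⟨ *-assoc (1/ p) p q ⟩
  1/ p * (p * q)    ≡⟨ cong (1/ p *_) pq≡0 ⟩
  1/ p * 0ℚ         ≡⟨ *-zeroʳ (1/ p) ⟩
  0ℚ                ∎
  where
  instance
    p-nonZero : ℚ.NonZero p
    p-nonZero = ℚ.≢-nonZero p≢0

-- A set of matrix positions, such as the unknowns of a linear system or the fractional entries.
Mask : ℕ → Set
Mask n = Fin n → Fin n → Bool

bit : Bool → ℕ
bit b = if b then 1 else 0

count : Mask n → ℕ
count p = ℕ∑.sum (λ i → ℕ∑.sum (λ j → bit (p i j)))

ℕ∑-zero : (f : Fin n → ℕ) → (∀ i → f i ≡ 0) → ℕ∑.sum f ≡ 0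
ℕ∑-zero {zero} f f≡0 = refl
ℕ∑-zero {suc n} f f≡0 = cong₂ ℕ._+_ (f≡0 zero) (ℕ∑-zero (f ∘ suc) (f≡0 ∘ suc))

nind : Fin n → Fin n → ℕ
nind a i = bit (does (a ≟ i))

ℕ∑-nind : (a : Fin n) → ℕ∑.sum (nind a) ≡ 1
ℕ∑-nind {suc n} zero = cong suc (ℕ∑-zero {n} (λ i → nind zero (suc i)) λ _ → refl)
ℕ∑-nind (suc a) = trans (ℕ∑.sum-cong-≗ {x = nind (suc a) ∘ suc} {y = nind a} λ i → refl) (ℕ∑-nind a)

remove : Fin n → Fin n → Mask n → Mask n
remove a b p i j = p i j ∧ not (does (a ≟ i) ∧ does (b ≟ j))

count-remove : (p : Mask n) {a b : Fin n} → p a b ≡ true → count p ≡ suc (count (remove a b p))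
count-remove p {a} {b} pab = begin
  count p
    ≡⟨ ℕ∑.sum-cong-≗ (λ i → ℕ∑.sum-cong-≗ (split i)) ⟩
  ℕ∑.sum (λ i → ℕ∑.sum (λ j → nind a i ℕ.* nind b j ℕ.+ bit (remove a b p i j)))
    ≡⟨ ℕ∑.sum-cong-≗ (λ i → ℕ∑.∑-distrib-+ (λ j → nind a i ℕ.* nind b j) (λ j → bit (remove a b p i j))) ⟩
  ℕ∑.sum (λ i → ℕ∑.sum (λ j → nind a i ℕ.* nind b j) ℕ.+ ℕ∑.sum (λ j → bit (remove a b p i j)))
    ≡⟨ ℕ∑.∑-distrib-+ (λ i → ℕ∑.sum (λ j → nind a i ℕ.* nind b j)) (λ i → ℕ∑.sum (λ j → bit (remove a b p i j))) ⟩
  ℕ∑.sum (λ i → ℕ∑.sum (λ j → nind a i ℕ.* nind b j)) ℕ.+ count (remove a b p)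
    ≡⟨ cong (ℕ._+ count (remove a b p)) (begin
         ℕ∑.sum (λ i → ℕ∑.sum (λ j → nind a i ℕ.* nind b j)) ≡⟨ ℕ∑.sum-cong-≗ (λ i → sym (ℕ∑.*-distribˡ-sum (nind a i) (nind b))) ⟩
         ℕ∑.sum (λ i → nind a i ℕ.* ℕ∑.sum (nind b))         ≡⟨ ℕ∑.sum-cong-≗ (λ i → trans (cong (nind a i ℕ.*_) (ℕ∑-nind b)) (ℕ.*-identityʳ (nind a i))) ⟩
         ℕ∑.sum (nind a)                                     ≡⟨ ℕ∑-nind a ⟩
         1                                                   ∎) ⟩
  suc (count (remove a b p)) ∎
  where
  split : ∀ i j → bit (p i j) ≡ nind a i ℕ.* nind b j ℕ.+ bit (remove a b p i j)
  split i j with a ≟ i | b ≟ j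
  ... | yes refl | yes refl rewrite pab = refl
  ... | yes _ | no _ with p i j
  ...   | true = refl
  ...   | false = refl
  split i j | no _ | _ with p i j
  ...   | true = refl
  ...   | false = refl

-- Gaussian elimination, without division: the pivot of the first row is eliminated from the other rows.
kernel : ∀ k (rows : Fin k → Mat n) (p : Mask n) → k ℕ.< count p →
  ∃ λ v → (∀ i j → p i j ≡ false → v i j ≡ 0ℚ) × (∃ λ i → ∃ λ j → v i j ≢ 0ℚ) × (∀ t → ⟪ rows t , v ⟫ ≡ 0ℚ)
kernel zero rows p 0<count with any? (λ i → any? (λ j → p i j Bool.≟ true))
... | yes (a , b , pab) = unit a b , off , (a , b , λ eq → 1≢0 (trans (sym unit-one) eq)) , λ ()
  where
  unit-one : unit a b a b ≡ 1ℚ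
  unit-one = cong₂ _*_ (ind-refl a) (ind-refl b)
  off : ∀ i j → p i j ≡ false → unit a b i j ≡ 0ℚ
  off i j pij = ind-*-zero {a = a} {b} λ { (refl , refl) → case trans (sym pij) pab of λ () }
... | no ∄ = contradiction (ℕ∑-zero _ λ i → ℕ∑-zero _ λ j → none i j) (ℕ.>⇒≢ 0<count)
  where
  none : ∀ i j → bit (p i j) ≡ 0
  none i j with p i j in eq
  ... | true = contradiction (i , j , eq) ∄
  ... | false = refl
kernel (suc k) rows p k<count with any? (λ i → any? (λ j → (p i j Bool.≟ true) ×-dec ¬? (rows zero i j ℚ.≟ 0ℚ)))
-- The first row vanishes on all unknowns, so every vector supported on them satisfies it.
... | no ∄ with v , off , nonzero , all ← kernel k (rows ∘ suc) p (ℕ.<-trans (ℕ.n<1+n k) k<count) =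
  v , off , nonzero , λ { zero → ⟪,⟫-zero (rows zero) v zero-or ; (suc t) → all t }
  where
  zero-or : ∀ i j → rows zero i j ≡ 0ℚ ⊎ v i j ≡ 0ℚ
  zero-or i j with p i j in eq | rows zero i j ℚ.≟ 0ℚ
  ... | _ | yes r≡0 = inj₁ r≡0
  ... | true | no r≢0 = contradiction (i , j , eq , r≢0) ∄
  ... | false | no _ = inj₂ (off i j eq)
kernel {n = n} (suc k) rows p k<count | yes (a , b , pab , r≢0)
  with v′ , off′ , (i₀ , j₀ , v′≢0) , all′ ← kernel k
    -- These combinations vanish at the pivot position, so this unknown can be removed.
    (λ t i j → rows zero a b * rows (suc t) i j + - rows (suc t) a b * rows zero i j) (remove a b p)
    (ℕ.≤-pred (subst (suc k ℕ.<_) (count-remove p pab) k<count)) =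
  v , off , (i₀ , j₀ , v≢0) , λ { zero → row-r ; (suc t) → row-r′ (rows (suc t)) (all′ t) }
  where
  r = rows zero
  s = ⟪ r , v′ ⟫
  v : Mat n
  -- The coefficient `- s` at the pivot is chosen so that the first row is satisfied. At every other
  -- position `v` is `v′` times the nonzero pivot.
  v i j = r a b * v′ i j + - s * unit a b i j
  ⟪_,v⟫ : ∀ f → ⟪ f , v ⟫ ≡ r a b * ⟪ f , v′ ⟫ + - s * f a b
  ⟪ f ,v⟫ = begin
    sum² (λ i j → f i j * (r a b * v′ i j + - s * unit a b i j))
      ≡⟨ sum²-cong (λ i j → solve 5 (λ f p v s u → f :* (p :* v :+ :- s :* u) := p :* (f :* v) :+ :- s :* (f :* u)) refl (f i j) (r a b) (v′ i j) s (unit a b i j)) ⟩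
    sum² (λ i j → r a b * (f i j * v′ i j) + - s * (f i j * unit a b i j))
      ≡⟨ sum²-linear (r a b) (- s) (λ i j → f i j * v′ i j) (λ i j → f i j * unit a b i j) ⟩
    r a b * ⟪ f , v′ ⟫ + - s * sum² (λ i j → f i j * unit a b i j)
      ≡⟨ cong (λ t → r a b * ⟪ f , v′ ⟫ + - s * t) (sum²-unit f a b) ⟩
    r a b * ⟪ f , v′ ⟫ + - s * f a b ∎
  row-r : ⟪ r , v ⟫ ≡ 0ℚ
  row-r = trans ⟪ r ,v⟫ (solve 2 (λ p s → p :* s :+ :- s :* p := con 0ℚ) refl (r a b) s)
  row-r′ : ∀ r′ → ⟪ (λ i j → r a b * r′ i j + - r′ a b * r i j) , v′ ⟫ ≡ 0ℚ → ⟪ r′ , v ⟫ ≡ 0ℚ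
  row-r′ r′ eq = begin
    ⟪ r′ , v ⟫
      ≡⟨ ⟪ r′ ,v⟫ ⟩
    r a b * ⟪ r′ , v′ ⟫ + - s * r′ a b
      ≡⟨ solve 4 (λ p t s q → p :* t :+ :- s :* q := p :* t :+ :- q :* s) refl (r a b) ⟪ r′ , v′ ⟫ s (r′ a b) ⟩
    r a b * ⟪ r′ , v′ ⟫ + - r′ a b * s
      ≡⟨ sym (sum²-linear (r a b) (- r′ a b) (λ i j → r′ i j * v′ i j) (λ i j → r i j * v′ i j)) ⟩
    sum² (λ i j → r a b * (r′ i j * v′ i j) + - r′ a b * (r i j * v′ i j))
      ≡⟨ sum²-cong (λ i j → solve 5 (λ p t v q u → p :* (t :* v) :+ :- q :* (u :* v) := (p :* t :+ :- q :* u) :* v) refl (r a b) (r′ i j) (v′ i j) (r′ a b) (r i j)) ⟩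
    ⟪ (λ i j → r a b * r′ i j + - r′ a b * r i j) , v′ ⟫
      ≡⟨ eq ⟩
    0ℚ ∎
  removed : remove a b p a b ≡ false
  removed rewrite dec-true (a ≟ a) refl | dec-true (b ≟ b) refl | pab = refl
  kept : ∀ i j → p i j ≡ false → remove a b p i j ≡ false
  kept i j pij rewrite pij = refl
  unit-off : ∀ {i j} → ¬ (i ≡ a × j ≡ b) → v i j ≡ r a b * v′ i j
  unit-off {i} {j} ¬ab = trans (cong (λ t → r a b * v′ i j + - s * t) (ind-*-zero {a = a} {b} ¬ab))
    (solve 2 (λ x s → x :+ :- s :* con 0ℚ := x) refl (r a b * v′ i j) s)
  off : ∀ i j → p i j ≡ false → v i j ≡ 0ℚ
  off i j pij = trans (unit-off λ { (refl , refl) → case trans (sym pij) pab of λ () })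
    (trans (cong (r a b *_) (off′ i j (kept i j pij))) (*-zeroʳ (r a b)))
  v≢0 : v i₀ j₀ ≢ 0ℚ
  v≢0 eq = v′≢0 (*-cancel-≢0 r≢0 (trans (sym (unit-off λ { (refl , refl) → v′≢0 (off′ a b removed) })) eq))

-- The graph of fractional values

sum-split : (P : Fin n → Bool) (f : Fin n → ℚ) →
  sum f ≡ sum (λ i → if P i then f i else 0ℚ) + sum (λ i → if P i then 0ℚ else f i)
sum-split P f = trans (sum-cong-≗ pointwise)
  (∑-distrib-+ (λ i → if P i then f i else 0ℚ) (λ i → if P i then 0ℚ else f i))
  where
  pointwise : ∀ i → f i ≡ (if P i then f i else 0ℚ) + (if P i then 0ℚ else f i)
  pointwise i with P i
  ... | true = sym (+-identityʳ (f i))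
  ... | false = sym (+-identityˡ (f i))

IsInt-restrict : (P : Fin n → Bool) (f : Fin n → ℚ) → (∀ i → P i ≡ false → IsInt (f i)) →
  IsInt (sum f) → IsInt (sum (λ i → if P i then f i else 0ℚ))
IsInt-restrict P f int∉ int =
  IsInt-cancelʳ (subst IsInt (sum-split P f) int) (IsInt-sum (λ i → if P i then 0ℚ else f i) rest)
  where
  rest : ∀ i → IsInt (if P i then 0ℚ else f i)
  rest i with P i in eq
  ... | true = IsInt-0
  ... | false = int∉ i eq

IsInt-one : (f : Fin n → ℚ) (a : Fin n) → (∀ i → i ≢ a → IsInt (f i)) → IsInt (sum f) → IsInt (f a)
IsInt-one f a int≢ int = subst IsInt (trans (sum-one _ a off) at) (IsInt-restrict P f int≢′ int)
  where
  P : Fin _ → Bool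
  P i = does (i ≟ a)
  int≢′ : ∀ i → P i ≡ false → IsInt (f i)
  int≢′ i eq with i ≟ a
  ... | no i≢a = int≢ i i≢a
  off : ∀ i → i ≢ a → (if P i then f i else 0ℚ) ≡ 0ℚ
  off i i≢a rewrite dec-false (i ≟ a) i≢a = refl
  at : (if P a then f a else 0ℚ) ≡ f a
  at rewrite dec-true (a ≟ a) refl = refl

IsInt-two : (f : Fin n → ℚ) {a b : Fin n} → a ≢ b → (∀ i → i ≢ a → i ≢ b → IsInt (f i)) → IsInt (sum f) → IsInt (f a + f b)
IsInt-two f {a} {b} a≢b int≢ int =
  subst IsInt (trans (sum-two _ a≢b off) (cong₂ _+_ at-a at-b)) (IsInt-restrict P f int≢′ int)
  where
  P : Fin _ → Bool
  P i = does (i ≟ a) ∨ does (i ≟ b)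
  int≢′ : ∀ i → P i ≡ false → IsInt (f i)
  int≢′ i eq with i ≟ a | i ≟ b
  ... | no i≢a | no i≢b = int≢ i i≢a i≢b
  off : ∀ i → i ≢ a → i ≢ b → (if P i then f i else 0ℚ) ≡ 0ℚ
  off i i≢a i≢b rewrite dec-false (i ≟ a) i≢a | dec-false (i ≟ b) i≢b = refl
  at-a : (if P a then f a else 0ℚ) ≡ f a
  at-a rewrite dec-true (a ≟ a) refl = refl
  at-b : (if P b then f b else 0ℚ) ≡ f b
  at-b rewrite dec-false (b ≟ a) (a≢b ∘ sym) | dec-true (b ≟ b) refl = refl

is01? : ∀ q → Dec (Is01 q)
is01? q = (q ℚ.≟ 0ℚ) ⊎-dec (q ℚ.≟ 1ℚ)

Frac : ℚ → Set
Frac q = ¬ Is01 q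

frac? : ∀ q → Dec (Frac q)
frac? q = ¬? (is01? q)

¬Frac⇒01 : ∀ {q} → ¬ Frac q → Is01 q
¬Frac⇒01 {q} = decidable-stable (is01? q)

-- Extremality in linear form: a perturbation that is supported on the fractional entries and keeps
-- the column sums could be scaled so that adding and subtracting it both stay within the bounds.
Rigid : Mat n → Set
Rigid X = ∀ δ → Symm δ → (∀ i j → Is01 (X i j) → δ i j ≡ 0ℚ) → (∀ j → colsum δ j ≡ 0ℚ) → ∀ i j → δ i j ≡ 0ℚ

-- The properties of a vertex of P(d) that determine the structure of F. They pass to the matrices
-- obtained by rounding, so that the argument can be repeated there.
record Basic (X : Mat n) : Set where
  field
    symmetric : Symm X
    bounds : ∀ i j → 0ℚ ≤ X i j × X i j ≤ 1ℚ
    integral : ∀ j → IsInt (colsum X j)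
    rigid : Rigid X

Frac-bounds : ∀ {q} → Frac q → 0ℚ ≤ q × q ≤ 1ℚ → 0ℚ < q × q < 1ℚ
Frac-bounds frac (0≤q , q≤1) =
  ≰⇒> (λ q≤0 → frac (inj₁ (≤-antisym q≤0 0≤q))) , ≰⇒> (λ 1≤q → frac (inj₂ (≤-antisym q≤1 1≤q)))

sumℕ² : (Fin n → Fin n → ℕ) → ℕ
sumℕ² g = ℕ∑.sum (λ i → ℕ∑.sum (g i))

upper : (Fin n → Fin n → ℕ) → Fin n → Fin n → ℕ
upper g i j = if does (i <? j) then g i j else 0

-- Each unordered pair is counted once from each of its ends. This serves both for the number of
-- edges of F and for the parity of a degree sum.
handshake : (g : Fin n → Fin n → ℕ) → (∀ i j → g i j ≡ g j i) → (∀ i → g i i ≡ 0) →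
  sumℕ² g ≡ sumℕ² (upper g) ℕ.+ sumℕ² (upper g)
handshake g comm diag = begin
  sumℕ² g
    ≡⟨ ℕ∑.sum-cong-≗ (λ i → trans (ℕ∑.sum-cong-≗ (split i)) (ℕ∑.∑-distrib-+ (upper g i) (λ j → upper g j i))) ⟩
  ℕ∑.sum (λ i → ℕ∑.sum (upper g i) ℕ.+ ℕ∑.sum (λ j → upper g j i))
    ≡⟨ ℕ∑.∑-distrib-+ (λ i → ℕ∑.sum (upper g i)) (λ i → ℕ∑.sum (λ j → upper g j i)) ⟩
  sumℕ² (upper g) ℕ.+ ℕ∑.sum (λ i → ℕ∑.sum (λ j → upper g j i))
    ≡⟨ cong (sumℕ² (upper g) ℕ.+_) (ℕ∑.∑-comm (λ i j → upper g j i)) ⟩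
  sumℕ² (upper g) ℕ.+ sumℕ² (upper g) ∎
  where
  split : ∀ i j → g i j ≡ upper g i j ℕ.+ upper g j i
  split i j with <-cmp i j
  ... | tri< i<j _ j≮i rewrite dec-true (i <? j) i<j | dec-false (j <? i) j≮i = sym (ℕ.+-identityʳ (g i j))
  ... | tri≈ i≮i refl _ rewrite dec-false (i <? i) i≮i = diag i
  ... | tri> i≮j _ j<i rewrite dec-false (i <? j) i≮j | dec-true (j <? i) j<i = comm i j

ℕ∑-mono : {f g : Fin n → ℕ} → (∀ i → f i ℕ.≤ g i) → ℕ∑.sum f ℕ.≤ ℕ∑.sum g
ℕ∑-mono {zero} f≤g = ℕ.z≤n
ℕ∑-mono {suc n} f≤g = ℕ.+-mono-≤ (f≤g zero) (ℕ∑-mono (f≤g ∘ suc))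

two≤ : (p : Fin n → Bool) {a b : Fin n} → a ≢ b → p a ≡ true → p b ≡ true → 2 ℕ.≤ ℕ∑.sum (bit ∘ p)
two≤ p {a} {b} a≢b pa pb = subst (ℕ._≤ ℕ∑.sum (bit ∘ p))
  (trans (ℕ∑.∑-distrib-+ (nind a) (nind b)) (cong₂ ℕ._+_ (ℕ∑-nind a) (ℕ∑-nind b)))
  (ℕ∑-mono pointwise)
  where
  pointwise : ∀ i → nind a i ℕ.+ nind b i ℕ.≤ bit (p i)
  pointwise i with a ≟ i | b ≟ i
  ... | yes refl | yes refl = contradiction refl a≢b
  ... | yes refl | no _ rewrite pa = ℕ.≤-refl
  ... | no _ | yes refl rewrite pb = ℕ.≤-refl
  ... | no _ | no _ = ℕ.z≤n

three≤ : (p : Fin n → Bool) {a b c : Fin n} → a ≢ b → a ≢ c → b ≢ c → p a ≡ true → p b ≡ true → p c ≡ true →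
  3 ℕ.≤ ℕ∑.sum (bit ∘ p)
three≤ p {a} {b} {c} a≢b a≢c b≢c pa pb pc = subst (ℕ._≤ ℕ∑.sum (bit ∘ p))
  (trans (ℕ∑.∑-distrib-+ (nind a) (λ i → nind b i ℕ.+ nind c i))
    (cong₂ ℕ._+_ (ℕ∑-nind a) (trans (ℕ∑.∑-distrib-+ (nind b) (nind c)) (cong₂ ℕ._+_ (ℕ∑-nind b) (ℕ∑-nind c)))))
  (ℕ∑-mono pointwise)
  where
  pointwise : ∀ i → nind a i ℕ.+ (nind b i ℕ.+ nind c i) ℕ.≤ bit (p i)
  pointwise i with a ≟ i | b ≟ i | c ≟ i
  ... | yes refl | yes refl | _ = contradiction refl a≢b
  ... | yes refl | no _ | yes refl = contradiction refl a≢c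
  ... | no _ | yes refl | yes refl = contradiction refl b≢c
  ... | yes refl | no _ | no _ rewrite pa = ℕ.≤-refl
  ... | no _ | yes refl | no _ rewrite pb = ℕ.≤-refl
  ... | no _ | no _ | yes refl rewrite pc = ℕ.≤-refl
  ... | no _ | no _ | no _ = ℕ.z≤n

length-filter : ∀ {P : Fin n → Set} (P? : ∀ i → Dec (P i)) → length (filter P? (allFin n)) ≡ ℕ∑.sum (λ i → bit (does (P? i)))
length-filter P? = go id
  where
  go : ∀ {m} (f : Fin m → Fin _) → length (filter P? (tabulate f)) ≡ ℕ∑.sum (λ i → bit (does (P? (f i))))
  go {zero} f = refl
  go {suc m} f with does (P? (f zero))
  ... | true = cong suc (go (f ∘ suc))
  ... | false = go (f ∘ suc)

m+m-cancel-≤ : ∀ {k c} → suc (k ℕ.+ k) ℕ.≤ c ℕ.+ c → k ℕ.< c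
m+m-cancel-≤ {k} {c} le = ℕ.≰⇒> λ c≤k → ℕ.<-irrefl refl (ℕ.≤-trans le (ℕ.+-mono-≤ c≤k c≤k))

-- The row on the left is the incidence vector of `u`. The symmetrization of `v` appears on the
-- right because the weighting `v` will live on one entry of each pair.
sum²-row : (u : Fin n) (v : Mat n) → ⟪ (λ i j → ind u i + ind u j) , v ⟫ ≡ colsum (λ i j → v i j + v j i) u
sum²-row u v = begin
  sum² (λ i j → (ind u i + ind u j) * v i j)
    ≡⟨ sum²-cong (λ i j → *-distribʳ-+ (v i j) (ind u i) (ind u j)) ⟩
  sum (λ i → sum (λ j → ind u i * v i j + ind u j * v i j))
    ≡⟨ sum-cong-≗ (λ i → trans (∑-distrib-+ (λ j → ind u i * v i j) (λ j → ind u j * v i j))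
         (cong₂ _+_ (sym (*-distribˡ-sum (ind u i) (v i))) (sum-ind-* u (v i)))) ⟩
  sum (λ i → ind u i * sum (v i) + v i u)
    ≡⟨ ∑-distrib-+ (λ i → ind u i * sum (v i)) (λ i → v i u) ⟩
  sum (λ i → ind u i * sum (v i)) + sum (λ i → v i u)
    ≡⟨ cong (_+ sum (λ i → v i u)) (sum-ind-* u (λ i → sum (v i))) ⟩
  sum (v u) + sum (λ i → v i u)
    ≡⟨ +-comm (sum (v u)) (sum (λ i → v i u)) ⟩
  sum (λ i → v i u) + sum (v u)
    ≡⟨ sym (∑-distrib-+ (λ i → v i u) (v u)) ⟩
  sum (λ i → v i u + v u i) ∎

module _ {X : Mat n} (B : Basic X) where

  open Basic B

  Frac-comm : ∀ {i j} → Frac (X i j) → Frac (X j i)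
  Frac-comm {i} {j} = subst Frac (symmetric .comm i j)

  -- Otherwise `X v u` would be the only non-integral term in an integral column sum.
  other-Frac : ∀ {u v} → Frac (X v u) → ∃ λ w → w ≢ v × Frac (X w u)
  other-Frac {u} {v} fr with any? (λ w → ¬? (w ≟ v) ×-dec frac? (X w u))
  ... | yes p = p
  ... | no ∄ = contradiction
    (int-01 (IsInt-one (λ i → X i u) v (λ i i≢v → Is01⇒IsInt (¬Frac⇒01 λ f → ∄ (i , i≢v , f))) (integral u))
      (bounds v u .proj₁) (bounds v u .proj₂)) fr

  private
    -- `edgeMask` keeps one of the two entries of each fractional pair, so that it counts the edges
    -- of F; `fracMask` counts each of them twice.
    fracMask edgeMask : Mask n
    fracMask i j = does (frac? (X i j))
    edgeMask i j = does (i <? j) ∧ fracMask i j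

    count-edges : count fracMask ≡ count edgeMask ℕ.+ count edgeMask
    count-edges = trans
      (handshake (λ i j → bit (fracMask i j)) (λ i j → cong (λ q → bit (does (frac? q))) (symmetric .comm i j))
        (λ i → cong (λ q → bit (does (frac? q))) (symmetric .diag i)))
      (cong (λ c → c ℕ.+ c) (ℕ∑.sum-cong-≗ λ i → ℕ∑.sum-cong-≗ λ j → upper-bit i j))
      where
      upper-bit : ∀ i j → upper (λ i j → bit (fracMask i j)) i j ≡ bit (edgeMask i j)
      upper-bit i j with does (i <? j)
      ... | true = refl
      ... | false = refl

    Supported : Fin n → Set
    Supported u = ∃ λ i → Frac (X i u)

    supported? : ∀ u → Dec (Supported u)
    supported? u = any? (λ i → frac? (X i u))

    support : List (Fin n)
    support = filter supported? (allFin n)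

    frac-true : ∀ {i j} → Frac (X i j) → fracMask j i ≡ true
    frac-true {i} {j} f = dec-true (frac? (X j i)) (Frac-comm f)

    2≤degree : ∀ u → bit (does (supported? u)) ℕ.+ bit (does (supported? u)) ℕ.≤ ℕ∑.sum (λ i → bit (fracMask u i))
    2≤degree u with supported? u
    ... | no _ = ℕ.z≤n
    ... | yes (v , f) with w , w≢v , g ← other-Frac f =
      two≤ (fracMask u) (w≢v ∘ sym) (frac-true f) (frac-true g)

  -- Otherwise there are more fractional pairs than vertices covered by them, so that the system for a
  -- weighting of these pairs with zero sum at each vertex has a nonzero solution.
  at-most-two : ∀ {u a b c} → a ≢ b → a ≢ c → b ≢ c → Frac (X a u) → Frac (X b u) → ¬ Frac (X c u)
  at-most-two {u} {a} {b} {c} a≢b a≢c b≢c fa fb fc =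
    let v , off , (i , j , v≢0) , rows-zero = kernel (length support)
          (λ t i j → ind (lookup support t) i + ind (lookup support t) j) edgeMask
          -- All degrees in F at supported vertices are at least 2, and the degree of `u` is at
          -- least 3. So twice the number of edges exceeds twice the number of vertices.
          (m+m-cancel-≤ (subst₂ ℕ._≤_ total count-edges (ℕ∑-mono bound)))
    in v≢0 (v-zero v off rows-zero i j)
    where
    s : Fin n → ℕ
    s u = bit (does (supported? u))
    total : ℕ∑.sum (λ w → nind u w ℕ.+ (s w ℕ.+ s w)) ≡ suc (length support ℕ.+ length support)
    total = begin
      ℕ∑.sum (λ w → nind u w ℕ.+ (s w ℕ.+ s w))
        ≡⟨ ℕ∑.∑-distrib-+ (nind u) (λ w → s w ℕ.+ s w) ⟩
      ℕ∑.sum (nind u) ℕ.+ ℕ∑.sum (λ w → s w ℕ.+ s w)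
        ≡⟨ cong₂ ℕ._+_ (ℕ∑-nind u) (ℕ∑.∑-distrib-+ s s) ⟩
      suc (ℕ∑.sum s ℕ.+ ℕ∑.sum s)
        ≡⟨ cong (λ k → suc (k ℕ.+ k)) (sym (length-filter supported?)) ⟩
      suc (length support ℕ.+ length support) ∎
    bound : ∀ w → nind u w ℕ.+ (s w ℕ.+ s w) ℕ.≤ ℕ∑.sum (λ i → bit (fracMask w i))
    bound w with u ≟ w
    ... | no _ = 2≤degree w
    ... | yes refl rewrite dec-true (supported? u) (a , fa) =
      three≤ (fracMask u) a≢b a≢c b≢c (frac-true fa) (frac-true fb) (frac-true fc)
    v-zero : ∀ v → (∀ i j → edgeMask i j ≡ false → v i j ≡ 0ℚ) →
      (∀ t → ⟪ (λ i j → ind (lookup support t) i + ind (lookup support t) j) , v ⟫ ≡ 0ℚ) → ∀ i j → v i j ≡ 0ℚ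
    v-zero v off rows-zero i j with i <? j
    ... | no i≮j = off i j (cong (_∧ fracMask i j) (dec-false (i <? j) i≮j))
    ... | yes i<j = begin
      v i j          ≡⟨ sym (+-identityʳ (v i j)) ⟩
      v i j + 0ℚ     ≡⟨ cong (v i j +_) (sym (off j i (cong (_∧ fracMask j i) (dec-false (j <? i) (Fin.<-asym i<j))))) ⟩
      v i j + v j i  ≡⟨ rigid δ δ-symm δ-off δ-colsum i j ⟩
      0ℚ             ∎
      where
      -- The solution lives above the diagonal; `rigid` applies to its symmetrization.
      δ : Mat n
      δ i j = v i j + v j i
      01-off : ∀ i j → Is01 (X i j) → v i j ≡ 0ℚ
      01-off i j 01x = off i j (trans (cong (does (i <? j) ∧_) (dec-false (frac? (X i j)) (λ f → f 01x))) (Bool.∧-zeroʳ _))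
      δ-symm : Symm δ
      δ-symm .comm i j = +-comm (v i j) (v j i)
      δ-symm .diag i = let vii = 01-off i i (inj₁ (symmetric .diag i)) in cong₂ _+_ vii vii
      δ-off : ∀ i j → Is01 (X i j) → δ i j ≡ 0ℚ
      δ-off i j 01x = cong₂ _+_ (01-off i j 01x) (01-off j i (subst Is01 (symmetric .comm i j) 01x))
      δ-colsum : ∀ w → colsum δ w ≡ 0ℚ
      δ-colsum w with supported? w
      ... | no ∄ = sum-zero _ λ i → δ-off i w (¬Frac⇒01 λ f → ∄ (i , f))
      ... | yes sw = trans (sym (sum²-row w v))
        (subst (λ w → ⟪ (λ i j → ind w i + ind w j) , v ⟫ ≡ 0ℚ) (sym (lookup-index w∈)) (rows-zero (index w∈)))
        where
        w∈ : w ∈ support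
        w∈ = ∈-filter⁺ supported? (∈-allFin w) sw

  -- All other entries of the column are integral, so the sum is an integer strictly between 0 and
  -- 2.
  Frac-pair : ∀ {u a b} → a ≢ b → Frac (X a u) → Frac (X b u) → X a u + X b u ≡ 1ℚ
  Frac-pair {u} {a} {b} a≢b fa fb =
    int-strictly-02
      (IsInt-two (λ i → X i u) a≢b
        (λ i i≢a i≢b → Is01⇒IsInt (¬Frac⇒01 (at-most-two a≢b (i≢a ∘ sym) (i≢b ∘ sym) fa fb))) (integral u))
      (+-mono-< (Frac-bounds fa (bounds a u) .proj₁) (Frac-bounds fb (bounds b u) .proj₁))
      (+-mono-< (Frac-bounds fa (bounds a u) .proj₂) (Frac-bounds fb (bounds b u) .proj₂))

-- Cycles of fractional pairs

Chain-last : {E : Fin n → Fin n → Set} → ∀ a bs z → Chain E a bs z → E (lastVertex a bs) z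
Chain-last a [] z e = e
Chain-last a (b ∷ bs) z (_ , c) = Chain-last b bs z c

-- The counterpart of `lay-elim` for claims that depend on where the values are written and not on
-- what they are.
lay-elim-chain : (P : Fin n → Fin n → ℚ → Set) → ∀ v a bs z → Chain (λ i j → ∀ w → P i j w × P j i w) a bs z →
  (∀ i j → P i j (X i j)) → ∀ i j → P i j (lay v a bs z X i j)
lay-elim-chain P v a [] z c pX = set-elim P (c v .proj₁) (c v .proj₂) pX
lay-elim-chain P v a (b ∷ bs) z (e , c) pX =
  set-elim P (e v .proj₁) (e v .proj₂) (lay-elim-chain P (1ℚ - v) b bs z c pX)

module _ {E : Fin n → Fin n → Set} (E-sym : ∀ {i j} → E i j → E j i) where

  path-neighbours : ∀ a bs z → IsPath a bs z → Chain E a bs z → ∀ {v} → v ∈ bs →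
    ∃ λ s → ∃ λ t → s ≢ t × E s v × E t v
  path-neighbours a (b ∷ []) z u (e , f) (here refl) =
    a , z , head≢ u (there (here refl)) , e , E-sym f
  path-neighbours a (b ∷ c ∷ bs) z u (e , f , _) (here refl) =
    a , c , head≢ u (there (here refl)) , e , E-sym f
  path-neighbours a (b ∷ bs) z (_ ∷ u) (_ , c) (there v∈) = path-neighbours b bs z u c v∈

  -- `E` can carry further facts about the two pairs at a vertex. Together with `at-most-two` these
  -- are facts about all fractional pairs there.
  cycle-neighbours : ∀ a b c cs → IsCycle a b c cs → Chain E a (b ∷ c ∷ cs) a → ∀ {v} → v ∈ a ∷ b ∷ c ∷ cs →
    ∃ λ s → ∃ λ t → s ≢ t × E s v × E t v
  cycle-neighbours a b c cs u ch@(e , _) (here refl) =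
    b , lastVertex c cs , head≢ u (∈-++⁺ˡ (lastVertex∈ c cs)) , E-sym e , Chain-last a (b ∷ c ∷ cs) a ch
  cycle-neighbours a b c cs u@(_ ∷ u′) (e , f , _) (there (here refl)) =
    a , c , (λ { refl → last∉ (c ∷ cs) u′ (here refl) }) , e , E-sym f
  cycle-neighbours a b c cs u (_ , ch) (there (there v∈)) = path-neighbours b (c ∷ cs) a u ch v∈

lookup-injective : {xs : List (Fin n)} → Unique xs → ∀ {i j} → lookup xs i ≡ lookup xs j → i ≡ j
lookup-injective {xs = x ∷ xs} u {zero} {zero} eq = refl
lookup-injective {xs = x ∷ xs} u {zero} {suc j} eq = contradiction (subst (_∈ xs) (sym eq) (∈-lookup j)) (head∉ u)
lookup-injective {xs = x ∷ xs} u {suc i} {zero} eq = contradiction (subst (_∈ xs) eq (∈-lookup i)) (head∉ u)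
lookup-injective {xs = x ∷ xs} (_ ∷ u) {suc i} {suc j} eq = cong suc (lookup-injective u eq)

Unique⇒length≤ : {xs : List (Fin n)} → Unique xs → length xs ℕ.≤ n
Unique⇒length≤ u = Fin.injective⇒≤ (lookup-injective u)

-- Cuts a path at the vertex to which a new edge returns, in order to close a cycle.
truncatePath : {E : Fin n → Fin n → Set} → ∀ {w} a bs z → w ∈ bs ++ z ∷ [] → Chain E a bs z → IsPath a bs z →
  ∃ λ xs → Chain E a xs w × IsPath a xs w × (∀ {i} → i ∈ xs ++ w ∷ [] → i ∈ bs ++ z ∷ [])
truncatePath a [] z (here refl) e u = [] , e , u , id
truncatePath a (b ∷ bs) z (here refl) (e , _) u =
  [] , e , (head≢ u (here refl) ∷ []) ∷ [] ∷ [] , λ { (here p) → here p }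
truncatePath {E = E} a (b ∷ bs) z (there w∈) (e , c) u@(_ ∷ u′) with truncatePath {E = E} b bs z w∈ c u′
... | xs , c′ , v , sub = b ∷ xs , (e , c′) , Unique-∷ (head∉ u ∘ sub′) v , sub′
  where
  sub′ : ∀ {i} → i ∈ b ∷ xs ++ _ ∷ [] → i ∈ b ∷ bs ++ z ∷ []
  sub′ (here p) = here p
  sub′ (there p) = there (sub p)

module _ {X : Mat n} (B : Basic X) where

  open Basic B

  Frac² : Fin n → Fin n → Set
  Frac² i j = Frac (X i j)

  Frac-next : ∀ {a b c} → a ≢ c → Frac² a b → Frac² b c → X b c ≡ 1ℚ - X a b
  Frac-next {a} {b} {c} a≢c fab fbc = begin
    X b c                      ≡⟨ symmetric .comm b c ⟩
    X c b                      ≡⟨ solve 2 (λ x y → y := (x :+ y) :- x) refl (X a b) (X c b) ⟩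
    (X a b + X c b) - X a b    ≡⟨ cong (_- X a b) (Frac-pair B a≢c fab (Frac-comm B fbc)) ⟩
    1ℚ - X a b                 ∎

  path-alternates : ∀ a b bs z → IsPath a (b ∷ bs) z → Chain Frac² a (b ∷ bs) z → AltM X (X a b) a (b ∷ bs) z
  path-alternates a b [] z u (e , f) = refl , Frac-next (head≢ u (there (here refl))) e f
  path-alternates a b (c ∷ bs) z u@(_ ∷ u′) (e , ch@(f , _)) =
    refl , subst (λ y → AltM X y b (c ∷ bs) z) (Frac-next (head≢ u (there (here refl))) e f) (path-alternates b c bs z u′ ch)

  module _ (a b c : Fin n) (cs : List (Fin n)) (u : IsCycle a b c cs) (ch : Chain Frac² a (b ∷ c ∷ cs) a) where

    private
      a≢c : a ≢ c
      a≢c refl = last∉ (c ∷ cs) (AllPairs.tail u) (here refl)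

    cycle-alternates : AltM X (X a b) a (b ∷ c ∷ cs) a
    cycle-alternates = refl ,
      subst (λ y → AltM X y b (c ∷ cs) a) (Frac-next a≢c (ch .proj₁) (ch .proj₂ .proj₁))
        (path-alternates b c cs a u (ch .proj₂))

    -- Changing the values of an even cycle to 1, 0, 1, … keeps the column sums.
    cycle-not-even : ¬ EvenLength (c ∷ cs)
    cycle-not-even even = ch .proj₁ (inj₂ (begin
      X a b                ≡⟨ solve 2 (λ x y → x := y :- (y :- x)) refl (X a b) (L a b) ⟩
      L a b - (L a b - X a b) ≡⟨ cong₂ _-_ (cycle-AltM a b c cs u {X = X} 1ℚ .proj₁) (rigid δ δ-symm δ-off δ-colsum a b) ⟩
      1ℚ                   ∎))
      where
      L δ : Mat n
      L = lay 1ℚ a (b ∷ c ∷ cs) a X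
      δ i j = L i j - X i j
      L-symm : Symm L
      L-symm = cycle-Symm a b c cs u 1ℚ symmetric
      δ-symm : Symm δ
      δ-symm .comm i j = cong₂ _-_ (L-symm .comm i j) (symmetric .comm i j)
      δ-symm .diag i = cong₂ _-_ (L-symm .diag i) (symmetric .diag i)
      δ-off : ∀ i j → Is01 (X i j) → δ i j ≡ 0ℚ
      δ-off i j 01x = trans (cong (_- X i j) (lay-elim-chain (λ i j q → Is01 (X i j) → q ≡ X i j) 1ℚ a (b ∷ c ∷ cs) a
        (Chain-map (λ f w → (λ 01y → contradiction 01y f) , λ 01y → contradiction 01y (Frac-comm B f)) a (b ∷ c ∷ cs) a ch)
        (λ _ _ _ → refl) i j 01x)) (+-inverseʳ (X i j))
      δ-colsum : ∀ j → colsum δ j ≡ 0ℚ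
      δ-colsum j = begin
        sum (λ i → L i j - X i j)
          ≡⟨ sum-cong-≗ (λ i → solve 2 (λ x y → x :- y := x :+ con (- 1ℚ) :* y) refl (L i j) (X i j)) ⟩
        sum (λ i → L i j + - 1ℚ * X i j)
          ≡⟨ trans (∑-distrib-+ (λ i → L i j) (λ i → - 1ℚ * X i j)) (cong (colsum L j +_) (sym (*-distribˡ-sum (- 1ℚ) (λ i → X i j)))) ⟩
        colsum L j + - 1ℚ * colsum X j
          ≡⟨ cong (_+ - 1ℚ * colsum X j) (cycle-colsum a b c cs u 1ℚ (X a b) symmetric cycle-alternates j) ⟩
        colsum X j + (s * ind a j + endSign (- s) (c ∷ cs) * ind a j) + - 1ℚ * colsum X j
          ≡⟨ cong (λ t → colsum X j + (s * ind a j + t * ind a j) + - 1ℚ * colsum X j) (endSign-even (- s) even) ⟩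
        colsum X j + (s * ind a j + - s * ind a j) + - 1ℚ * colsum X j
          ≡⟨ solve 3 (λ C s p → C :+ (s :* p :+ :- s :* p) :+ con (- 1ℚ) :* C := con 0ℚ) refl (colsum X j) s (ind a j) ⟩
        0ℚ ∎
        where
        s = 1ℚ - X a b

    cycle-odd : EvenLength cs
    cycle-odd with evenLength⊎ c cs
    ... | inj₁ even = even
    ... | inj₂ even = contradiction even cycle-not-even

    -- The first and last values of an odd alternating cycle agree, and as fractional values meeting
    -- at `a` they add up to 1.
    cycle-half : AltM X ½ a (b ∷ c ∷ cs) a
    cycle-half = subst (λ x → AltM X x a (b ∷ c ∷ cs) a) (begin
      X a b                        ≡⟨ solve 1 (λ x → x := con ½ :* (x :+ x)) refl (X a b) ⟩
      ½ * (X a b + X a b)          ≡⟨ cong (½ *_) (cong₂ _+_ (sym (AltM-last (X a b) (even-∷∷ cycle-odd) cycle-alternates)) (symmetric .comm a b)) ⟩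
      ½ * (X (lastVertex c cs) a + X b a)
        ≡⟨ cong (½ *_) (Frac-pair B (λ eq → head∉ u (subst (_∈ c ∷ cs ++ a ∷ []) eq (∈-++⁺ˡ (lastVertex∈ c cs))))
             (Chain-last a (b ∷ c ∷ cs) a ch) (Frac-comm B (ch .proj₁))) ⟩
      ½ * 1ℚ                       ≡⟨⟩
      ½                            ∎) cycle-alternates

    -- A vertex of the cycle has two fractional neighbours on the cycle and no third one, so the
    -- cycle is a whole component of F.
    cycle-closed : ∀ {w v} → v ∈ a ∷ b ∷ c ∷ cs → Frac² w v → w ∈ a ∷ b ∷ c ∷ cs
    cycle-closed {w} {v} v∈ f =
      let s , t , s≢t , (fs , s∈ , _) , (ft , t∈ , _) =
            cycle-neighbours {E = λ i j → Frac² i j × i ∈ C × j ∈ C} (λ (f , p , q) → Frac-comm B f , q , p) a b c cs u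
              (Chain-zip a (b ∷ c ∷ cs) a ch (Chain-map (λ (p , q) → verts-closed a (b ∷ c ∷ cs) p , verts-closed a (b ∷ c ∷ cs) q) a (b ∷ c ∷ cs) a (Chain-∈ a (b ∷ c ∷ cs) a))) v∈
      in decidable-stable (_∈?_ _≟_ w C) λ w∉ →
           at-most-two B s≢t (λ { refl → w∉ s∈ }) (λ { refl → w∉ t∈ }) fs ft f
      where
      C = a ∷ b ∷ c ∷ cs

    -- The two cycle pairs at `v` are fractional in `X` but no longer in `Y`; any other fractional
    -- entry of `Y` at `v` would be a third one of `X`.
    cycle-settled : ∀ {Y} → Symm Y → (∀ i j → Frac (Y i j) → Frac² i j) → Chain (λ i j → Is01 (Y i j)) a (b ∷ c ∷ cs) a →
      ∀ w {v} → v ∈ a ∷ b ∷ c ∷ cs → Is01 (Y w v)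
    cycle-settled {Y} sY sub ch01 w {v} v∈ =
      let s , t , s≢t , (fs , 01s) , (ft , 01t) =
            cycle-neighbours {E = λ i j → Frac² i j × Is01 (Y i j)}
              (λ {i} {j} (f , p) → Frac-comm B f , subst Is01 (sY .comm i j) p) a b c cs u
              (Chain-zip a (b ∷ c ∷ cs) a ch ch01) v∈
      in ¬Frac⇒01 λ f → at-most-two B s≢t (λ { refl → f 01s }) (λ { refl → f 01t }) fs ft (sub w v f)

  data FracCycle (P : Fin n → Set) : Set where
    fracCycle : ∀ a b c cs → IsCycle a b c cs → Chain Frac² a (b ∷ c ∷ cs) a →
      (∀ {i} → i ∈ a ∷ b ∷ c ∷ cs → P i) → FracCycle P

  module _ (P : Fin n → Set) (closed : ∀ {w v} → P v → Frac² w v → P w) where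

    private
      first : List (Fin n) → Fin n → Fin n
      first [] z = z
      first (b ∷ _) z = b

      Chain-first : ∀ {h} bs z → Chain Frac² h bs z → Frac² h (first bs z)
      Chain-first [] z e = e
      Chain-first (b ∷ bs) z (e , _) = e

      -- The number `k` bounds the remaining extensions: a path has at most `n` distinct vertices,
      -- so the search must end before `k` is used up.
      extend : ∀ k h bs z → n ℕ.< length (verts h bs z) ℕ.+ k → IsPath h bs z → Chain Frac² h bs z →
        (∀ {i} → i ∈ verts h bs z → P i) → FracCycle P

      grow : ∀ k h bs z w → n ℕ.< length (verts h bs z) ℕ.+ k → IsPath h bs z → Chain Frac² h bs z →
        (∀ {i} → i ∈ verts h bs z → P i) → w ≢ first bs z → Frac² w h → Dec (w ∈ verts h bs z) → FracCycle P
      grow zero h bs z w n< u ch inP w≢ f _ =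
        contradiction (Unique⇒length≤ u) (ℕ.<⇒≱ (subst (n ℕ.<_) (ℕ.+-identityʳ _) n<))
      grow (suc k) h bs z w n< u ch inP w≢ f (no w∉) =
        extend k w (h ∷ bs) z (subst (n ℕ.<_) (ℕ.+-suc _ k) n<) (Unique-∷ w∉ u) (f , ch)
          λ { (here refl) → closed (inP (here refl)) f ; (there i∈) → inP i∈ }
      grow (suc k) h bs z w n< u ch inP w≢ f (yes (here refl)) = contradiction (inj₁ (symmetric .diag w)) f
      grow (suc k) h [] z w n< u ch inP w≢ f (yes (there (here w≡z))) = contradiction w≡z w≢
      grow (suc k) h (b ∷ bs) z w n< u ch inP w≢ f (yes (there (here w≡b))) = contradiction w≡b w≢
      -- The new edge returns to the path beyond its second vertex `b`, so the cycle that it closes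
      -- has at least three vertices.
      grow (suc k) h (b ∷ bs) z w n< u@(_ ∷ u′) (e , ch) inP w≢ f (yes (there (there w∈))) =
        let xs , ch′ , v , sub = truncatePath {E = Frac²} b bs z w∈ ch u′
            sub′ : ∀ {i} → i ∈ b ∷ xs ++ w ∷ [] → i ∈ b ∷ bs ++ z ∷ []
            sub′ = λ { (here p) → here p ; (there p) → there (sub p) }
        in fracCycle w h b xs (Unique-∷ (head∉ u ∘ sub′) v) (f , e , ch′) λ
          { (here refl) → inP (there (there w∈))
          ; (there (here refl)) → inP (here refl)
          ; (there (there i∈)) → inP (there (sub′ (∈-++⁺ˡ i∈))) }

      extend k h bs z n< u ch inP =
        let w , w≢ , f = other-Frac B (Frac-comm B (Chain-first bs z ch))
        in grow k h bs z w n< u ch inP w≢ f (_∈?_ _≟_ w (verts h bs z))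

    -- As F has no vertex of degree 1, a path can be prolonged at its front until it meets itself. A
    -- set `P` closed under adjacency confines the search; this yields a second cycle disjoint from
    -- a given one.
    findCycle : ∀ {w v} → P v → Frac² w v → FracCycle P
    findCycle {w} {v} pv f = extend n w [] v (ℕ.n≤1+n (suc n))
      (((λ { refl → f (inj₁ (symmetric .diag w)) }) ∷ []) ∷ [] ∷ []) f
      λ { (here refl) → closed pv f ; (there (here refl)) → pv }

-- Rounding odd cycles in pairs

bit-mono : {P Q : Set} → (P → Q) → (p? : Dec P) (q? : Dec Q) → bit (does p?) ℕ.≤ bit (does q?)
bit-mono f (yes p) q? rewrite dec-true q? (f p) = ℕ.≤-refl
bit-mono f (no _) q? = ℕ.z≤n

ℕ∑-mono-< : {f g : Fin n → ℕ} (a : Fin n) → (∀ i → f i ℕ.≤ g i) → f a ℕ.< g a → ℕ∑.sum f ℕ.< ℕ∑.sum g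
ℕ∑-mono-< zero f≤g fa<ga = ℕ.+-mono-<-≤ fa<ga (ℕ∑-mono (f≤g ∘ suc))
ℕ∑-mono-< (suc a) f≤g fa<ga = ℕ.+-mono-≤-< (f≤g zero) (ℕ∑-mono-< a (f≤g ∘ suc) fa<ga)

fractional : Mat n → Mask n
fractional X i j = does (frac? (X i j))

-- The decrease of the measure for the induction in `no-Frac`.
fractional-< : (∀ i j → Frac (Y i j) → Frac (X i j)) → ∀ a b → Frac (X a b) → ¬ Frac (Y a b) →
  count (fractional Y) ℕ.< count (fractional X)
fractional-< {Y = Y} {X = X} sub a b fx ¬fy =
  ℕ∑-mono-< a (λ i → ℕ∑-mono (mono i)) (ℕ∑-mono-< b (mono a) strict)
  where
  mono : ∀ i j → bit (fractional Y i j) ℕ.≤ bit (fractional X i j)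
  mono i j = bit-mono (sub i j) (frac? (Y i j)) (frac? (X i j))
  strict : bit (fractional Y a b) ℕ.< bit (fractional X a b)
  strict rewrite dec-true (frac? (X a b)) fx | dec-false (frac? (Y a b)) ¬fy = ℕ.≤-refl

sumℕ-allFin : (f : Fin n → ℕ) → ℕ.sum (map f (allFin n)) ≡ ℕ∑.sum f
sumℕ-allFin f = trans (cong ℕ.sum (map-tabulate id f)) (go f)
  where
  go : ∀ {n} (f : Fin n → ℕ) → ℕ.sum (tabulate f) ≡ ℕ∑.sum f
  go {zero} f = refl
  go {suc n} f = cong (f zero ℕ.+_) (go (f ∘ suc))

degree-sum-even : {d : Fin n → ℕ} → Graphic d → ∃ λ m → ℕ∑.sum d ≡ 2 ℕ.* m
degree-sum-even {n} {d} (G , realizes) = e , (begin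
  ℕ∑.sum d        ≡⟨ ℕ∑.sum-cong-≗ (λ i → trans (sym (realizes i)) (sumℕ-allFin (λ j → bit (adj G i j)))) ⟩
  sumℕ² g         ≡⟨ handshake g (λ i j → cong bit (adj-sym G i j)) (λ i → cong bit (irrefl G i)) ⟩
  e ℕ.+ e         ≡⟨ cong (e ℕ.+_) (sym (ℕ.+-identityʳ e)) ⟩
  2 ℕ.* e         ∎)
  where
  g : Fin n → Fin n → ℕ
  g i j = bit (adj G i j)
  e = sumℕ² (upper g)

-- Both degree sums would be even, but they differ by one.
one-more-not-graphic : {d : Fin n → ℕ} (a : Fin n) → Graphic d → ¬ Graphic (λ i → d i ℕ.+ nind a i)
one-more-not-graphic {d = d} a g g′ =
  let m , even = degree-sum-even g
      m′ , even′ = degree-sum-even g′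
  in ℕ.even≢odd m′ m (begin
    2 ℕ.* m′                                ≡⟨ sym even′ ⟩
    ℕ∑.sum (λ i → d i ℕ.+ nind a i)         ≡⟨ ℕ∑.∑-distrib-+ d (nind a) ⟩
    ℕ∑.sum d ℕ.+ ℕ∑.sum (nind a)            ≡⟨ cong₂ ℕ._+_ even (ℕ∑-nind a) ⟩
    2 ℕ.* m ℕ.+ 1                           ≡⟨ ℕ.+-comm (2 ℕ.* m) 1 ⟩
    suc (2 ℕ.* m)                           ∎)

ι-nind : (a j : Fin n) → ι (ℤ.+ nind a j) ≡ ind a j
ι-nind a j with does (a ≟ j)
... | true = refl
... | false = refl

Frac-lay : ∀ v → Is01 v → ∀ a bs z → (Y : Mat n) → ∀ i j → Frac (lay v a bs z Y i j) → Frac (Y i j)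
Frac-lay v 01v a bs z Y = lay-elim (λ i j q → Frac q → Frac (Y i j)) v a bs z
  (λ i j f → contradiction 01v f) (λ i j f → contradiction (Is01-1- 01v) f) (λ i j → id)

AltM-01 : ∀ {x} → Is01 x → ∀ a bs z → AltM X x a bs z → Chain (λ i j → Is01 (X i j)) a bs z
AltM-01 01x a [] z refl = 01x
AltM-01 01x a (b ∷ bs) z (refl , alt) = 01x , AltM-01 (Is01-1- 01x) b bs z alt

-- With fewer fractional entries there are fewer perturbations to exclude.
Rigid-sub : (∀ i j → Frac (Y i j) → Frac (X i j)) → Rigid X → Rigid Y
Rigid-sub {X = X} sub rigid δ sδ off = rigid δ sδ λ i j 01x → off i j (¬Frac⇒01 λ f → sub i j f 01x)

module _ {d : Fin n → ℕ} {X : Mat n} (B : Basic X) (deg : ∀ j → colsum X j ≡ ι (ℤ.+ d j)) where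

  open Basic B

  -- Rounding a single odd cycle that carries all fractional values changes one degree by one.
  frac-outside-cycle : Graphic d → ∀ a b c cs → IsCycle a b c cs → Chain (Frac² B) a (b ∷ c ∷ cs) a →
    ∃ λ w → ∃ λ v → v ∉ a ∷ b ∷ c ∷ cs × Frac (X w v)
  frac-outside-cycle graphic a b c cs u ch
    with any? (λ w → any? (λ v → ¬? (_∈?_ _≟_ v (a ∷ b ∷ c ∷ cs)) ×-dec frac? (X w v)))
  ... | yes p = p
  ... | no ∄ = contradiction (toGraphic (toGraph L-symm L-01)) (one-more-not-graphic a graphic)
    where
    L : Mat n
    L = lay 1ℚ a (b ∷ c ∷ cs) a X
    L-symm : Symm L
    L-symm = cycle-Symm a b c cs u 1ℚ symmetric
    sub : ∀ i j → Frac (L i j) → Frac (X i j)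
    sub = Frac-lay 1ℚ (inj₂ refl) a (b ∷ c ∷ cs) a X
    L-01 : ∀ i j → Is01 (L i j)
    L-01 i j = ¬Frac⇒01 λ f → f (cycle-settled B a b c cs u ch L-symm sub
      (AltM-01 (inj₂ refl) a (b ∷ c ∷ cs) a (cycle-AltM a b c cs u {X = X} 1ℚ)) i
      (decidable-stable (_∈?_ _≟_ j (a ∷ b ∷ c ∷ cs)) λ j∉ → ∄ (i , j , j∉ , sub i j f)))
    L-colsum : ∀ j → colsum L j ≡ ι (ℤ.+ (d j ℕ.+ nind a j))
    L-colsum j = begin
      colsum L j
        ≡⟨ cycle-colsum a b c cs u 1ℚ ½ symmetric (cycle-half B a b c cs u ch) j ⟩
      colsum X j + ((1ℚ - ½) * ind a j + endSign (1ℚ - ½) (b ∷ c ∷ cs) * ind a j)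
        ≡⟨ cong (λ s → colsum X j + ((1ℚ - ½) * ind a j + s * ind a j)) (endSign-even (1ℚ - ½) (even-∷∷ {x = b} {c} (cycle-odd B a b c cs u ch))) ⟩
      colsum X j + ((1ℚ - ½) * ind a j + (1ℚ - ½) * ind a j)
        ≡⟨ cong (colsum X j +_) (solve 1 (λ p → con (1ℚ - ½) :* p :+ con (1ℚ - ½) :* p := p) refl (ind a j)) ⟩
      colsum X j + ind a j
        ≡⟨ cong₂ _+_ (deg j) (sym (ι-nind a j)) ⟩
      ι (ℤ.+ d j) + ι (ℤ.+ nind a j)
        ≡⟨ sym (ι-+ (ℤ.+ d j) (ℤ.+ nind a j)) ⟩
      ι (ℤ.+ (d j ℕ.+ nind a j)) ∎
    toGraphic : (Σ (Graph n) λ G → ∀ i j → matrix G i j ≡ L i j) → Graphic (λ i → d i ℕ.+ nind a i)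
    toGraphic (G , eq) = G , graph-degree G eq L-colsum

  -- The pattern of a blossom is present right after the rounding, but it is a blossom of a
  -- realization only once no fractional entry is left elsewhere; hence the hypothesis in `blossom`.
  record Rounding : Set where
    field
      rounded : Mat n
      basic : Basic rounded
      rounded-degrees : ∀ j → colsum rounded j ≡ ι (ℤ.+ d j)
      fewer : count (fractional rounded) ℕ.< count (fractional X)
      blossom : (∀ i j → Is01 (rounded i j)) → HasBlossom rounded d

  -- Both cycles are rounded so that their edges at a and a′ get the value x of the pair aa′,
  -- which makes up for the exchange of the value of aa′.
  roundPair : ∀ a b c cs → IsCycle a b c cs → Chain (Frac² B) a (b ∷ c ∷ cs) a →
    ∀ a′ b′ c′ cs′ → IsCycle a′ b′ c′ cs′ → Chain (Frac² B) a′ (b′ ∷ c′ ∷ cs′) a′ →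
    (∀ {i} → i ∈ a′ ∷ b′ ∷ c′ ∷ cs′ → i ∉ a ∷ b ∷ c ∷ cs) → Rounding
  roundPair a b c cs u ch a′ b′ c′ cs′ u′ ch′ disj = record
    { rounded = Z
    ; basic = record
        { symmetric = Z-symm
        ; bounds = Z-bounds
        ; integral = λ j → ℤ.+ d j , Z-degrees j
        ; rigid = Rigid-sub sub rigid }
    ; rounded-degrees = Z-degrees
    ; fewer = fractional-< sub a b (ch .proj₁) (λ f → f (subst Is01 (sym (Z-alt .proj₁)) 01x))
    ; blossom = λ Z-01 → hasBlossom (cycle-odd B a b c cs u ch) (cycle-odd B a′ b′ c′ cs′ u′ ch′) u′ record
        { real = record { symm = Z-symm ; is01 = Z-01 ; degrees = Z-degrees }
        ; cycle = u
        ; alt₁ = Z-alt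
        ; alt₂ = Z-alt′
        ; link = set-hit a a′ (1ℚ - x) L₂
        ; disjoint = λ p q → disj q p } }
    where
    C C′ : List (Fin n)
    C = a ∷ b ∷ c ∷ cs
    C′ = a′ ∷ b′ ∷ c′ ∷ cs′
    x = X a a′
    01x : Is01 x
    -- If the pair of base points were fractional, `a′` would lie on the first cycle.
    01x = ¬Frac⇒01 λ f → disj (here refl) (cycle-closed B a b c cs u ch (here refl) (Frac-comm B f))
    L₁ L₂ Z : Mat n
    L₁ = lay x a′ (b′ ∷ c′ ∷ cs′) a′ X
    L₂ = lay x a (b ∷ c ∷ cs) a L₁
    Z = set a a′ (1ℚ - x) L₂
    a≢a′ : a ≢ a′
    a≢a′ refl = disj (here refl) (here refl)
    L₁-symm : Symm L₁
    L₁-symm = cycle-Symm a′ b′ c′ cs′ u′ x symmetric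
    L₂-symm : Symm L₂
    L₂-symm = cycle-Symm a b c cs u x L₁-symm
    Z-symm : Symm Z
    Z-symm = set-Symm a≢a′ L₂-symm
    miss₁ : ∀ i j → i ∈ C → L₁ i j ≡ X i j
    miss₁ i j i∈ = lay-miss X x a′ (b′ ∷ c′ ∷ cs′) a′ (inj₁ λ p → disj (verts-closed a′ (b′ ∷ c′ ∷ cs′) p) i∈)
    miss₂ : ∀ i j → j ∈ C′ → L₂ i j ≡ L₁ i j
    miss₂ i j j∈ = lay-miss L₁ x a (b ∷ c ∷ cs) a {i} {j} (inj₂ λ p → disj j∈ (verts-closed a (b ∷ c ∷ cs) p))
    x-same : L₂ a a′ ≡ x
    x-same = trans (miss₂ a a′ (here refl)) (miss₁ a a′ (here refl))
    Z-alt : AltM Z x a (b ∷ c ∷ cs) a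
    Z-alt = AltM-cong-∈ {X = L₂} x a (b ∷ c ∷ cs) a
      (λ {i} {j} i∈ j∈ → set-miss a a′ (1ℚ - x) L₂ {i} {j} λ
        { (inj₁ (_ , refl)) → disj (here refl) (verts-closed a (b ∷ c ∷ cs) j∈)
        ; (inj₂ (refl , _)) → disj (here refl) (verts-closed a (b ∷ c ∷ cs) i∈) })
      (cycle-AltM a b c cs u {X = L₁} x)
    Z-alt′ : AltM Z x a′ (b′ ∷ c′ ∷ cs′) a′
    Z-alt′ = AltM-cong-∈ {X = L₁} x a′ (b′ ∷ c′ ∷ cs′) a′
      (λ {i} {j} i∈ j∈ → trans
        (set-miss a a′ (1ℚ - x) L₂ {i} {j} λ
          { (inj₁ (refl , _)) → disj (verts-closed a′ (b′ ∷ c′ ∷ cs′) i∈) (here refl)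
          ; (inj₂ (_ , refl)) → disj (verts-closed a′ (b′ ∷ c′ ∷ cs′) j∈) (here refl) })
        (miss₂ i j (verts-closed a′ (b′ ∷ c′ ∷ cs′) j∈)))
      (cycle-AltM a′ b′ c′ cs′ u′ {X = X} x)
    sub : ∀ i j → Frac (Z i j) → Frac (X i j)
    sub i j f = Frac-lay x 01x a′ (b′ ∷ c′ ∷ cs′) a′ X i j (Frac-lay x 01x a (b ∷ c ∷ cs) a L₁ i j
      (set-elim (λ i j q → Frac q → Frac (L₂ i j)) (λ g → contradiction (Is01-1- 01x) g)
        (λ g → contradiction (Is01-1- 01x) g) (λ _ _ → id) i j f))
    Z-bounds : ∀ i j → 0ℚ ≤ Z i j × Z i j ≤ 1ℚ
    Z-bounds = set-elim InUnit 1-x∈ 1-x∈ (lay-elim InUnit x a (b ∷ c ∷ cs) a (λ _ _ → x∈) (λ _ _ → 1-x∈)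
      (lay-elim InUnit x a′ (b′ ∷ c′ ∷ cs′) a′ (λ _ _ → x∈) (λ _ _ → 1-x∈) bounds))
      where
      InUnit : Fin n → Fin n → ℚ → Set
      InUnit _ _ q = 0ℚ ≤ q × q ≤ 1ℚ
      x∈ = Is01⇒bounds 01x
      1-x∈ = Is01⇒bounds (Is01-1- 01x)
    Z-degrees : ∀ j → colsum Z j ≡ ι (ℤ.+ d j)
    Z-degrees j = begin
      colsum Z j
        ≡⟨ set-colsum a≢a′ L₂-symm j ⟩
      colsum L₂ j + ((1ℚ - x) - L₂ a a′) * (ind a j + ind a′ j)
        ≡⟨ cong₂ (λ C y → C + ((1ℚ - x) - y) * (ind a j + ind a′ j)) colsum₂ x-same ⟩
      -- Each odd cycle adds `2(x - ½)` at its base point, and the exchange on `a a′` adds `1 - 2x`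
      -- at both base points.
      colsum X j + (s * ind a′ j + s * ind a′ j) + (s * ind a j + s * ind a j) + ((1ℚ - x) - x) * (ind a j + ind a′ j)
        ≡⟨ solve 4 (λ C x p q → C :+ ((x :- con ½) :* q :+ (x :- con ½) :* q) :+ ((x :- con ½) :* p :+ (x :- con ½) :* p) :+ ((con 1ℚ :- x) :- x) :* (p :+ q) := C) refl (colsum X j) x (ind a j) (ind a′ j) ⟩
      colsum X j
        ≡⟨ deg j ⟩
      ι (ℤ.+ d j) ∎
      where
      s = x - ½
      colsum₁ : colsum L₁ j ≡ colsum X j + (s * ind a′ j + s * ind a′ j)
      colsum₁ = trans (cycle-colsum a′ b′ c′ cs′ u′ x ½ symmetric (cycle-half B a′ b′ c′ cs′ u′ ch′) j)
        (cong (λ t → colsum X j + (s * ind a′ j + t * ind a′ j))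
          (endSign-even s (even-∷∷ {x = b′} {c′} (cycle-odd B a′ b′ c′ cs′ u′ ch′))))
      half : AltM L₁ ½ a (b ∷ c ∷ cs) a
      half = AltM-cong-∈ {X = X} ½ a (b ∷ c ∷ cs) a (λ {i} {j} i∈ _ → miss₁ i j (verts-closed a (b ∷ c ∷ cs) i∈)) (cycle-half B a b c cs u ch)
      colsum₂ : colsum L₂ j ≡ colsum X j + (s * ind a′ j + s * ind a′ j) + (s * ind a j + s * ind a j)
      colsum₂ = trans (cycle-colsum a b c cs u x ½ L₁-symm half j)
        (cong₂ (λ C t → C + (s * ind a j + t * ind a j)) colsum₁
          (endSign-even s (even-∷∷ {x = b} {c} (cycle-odd B a b c cs u ch))))

  -- Parity leaves a fractional pair outside the first cycle, and the complement of that cycle is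
  -- closed under adjacency in F, so a second cycle is found there.
  Frac⇒Rounding : Graphic d → ∀ {i j} → Frac (X i j) → Rounding
  Frac⇒Rounding graphic f = go (findCycle B (λ _ → ⊤) (λ _ _ → tt) tt f)
    where
    go : FracCycle B (λ _ → ⊤) → Rounding
    go (fracCycle a b c cs u ch _) =
      let w , v , v∉ , g = frac-outside-cycle graphic a b c cs u ch
      in go′ (findCycle B (_∉ a ∷ b ∷ c ∷ cs) (λ v∉ f w∈ → v∉ (cycle-closed B a b c cs u ch w∈ (Frac-comm B f))) v∉ g)
      where
      go′ : FracCycle B (_∉ a ∷ b ∷ c ∷ cs) → Rounding
      go′ (fracCycle a′ b′ c′ cs′ u′ ch′ out) = roundPair a b c cs u ch a′ b′ c′ cs′ u′ ch′ out

-- By induction on the number of fractional entries. If there is one, the rounded matrix has fewer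
-- of them, hence none, and so is a realization with a blossom.
no-Frac : {d : Fin n → ℕ} → Graphic d → NoBlossoms33 d → ∀ k {X : Mat n} → count (fractional X) ℕ.< k →
  Basic X → (∀ j → colsum X j ≡ ι (ℤ.+ d j)) → ∀ i j → ¬ Frac (X i j)
no-Frac graphic none (suc k) (ℕ.s≤s count≤k) B deg i j f =
  HasBlossom⇒¬33 (blossom λ i j → ¬Frac⇒01 (no-Frac graphic none k (ℕ.<-≤-trans fewer count≤k) basic rounded-degrees i j)) none
  where
  open Rounding (Frac⇒Rounding B deg graphic f)

-- Vertices of the polytope

p≤q⇒0≤q-p : ∀ {p q} → p ≤ q → 0ℚ ≤ q - p
p≤q⇒0≤q-p {p} {q} p≤q = subst (_≤ q - p) (+-inverseʳ p) (+-monoˡ-≤ (- p) p≤q)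

InUnit : ℚ → Set
InUnit q = 0ℚ ≤ q × q ≤ 1ℚ

Slack : ℚ → ℚ → Set
Slack x q = q ≤ x × q ≤ 1ℚ - x

perturb-unit : ∀ {x q} → InUnit x → 0ℚ ≤ q → Slack x q → InUnit (x + q) × InUnit (x - q)
perturb-unit {x} {q} (0≤x , x≤1) 0≤q (q≤x , q≤1-x) =
  (+-mono-≤ 0≤x 0≤q ,
   subst (x + q ≤_) (solve 1 (λ x → x :+ (con 1ℚ :- x) := con 1ℚ) refl x) (+-monoʳ-≤ x q≤1-x)) ,
  (p≤q⇒0≤q-p q≤x , ≤-trans (subst (x - q ≤_) (+-identityʳ x) (+-monoʳ-≤ x (neg-antimono-≤ 0≤q))) x≤1)

perturb-unit-∣∣ : ∀ {x e δ} → InUnit x → 0ℚ < e → Slack x (e * ∣ δ ∣) → InUnit (x + e * δ) × InUnit (x - e * δ)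
perturb-unit-∣∣ {x} {e} {δ} x∈ 0<e slack with perturb-unit x∈ 0≤q slack | ∣p∣≡p∨∣p∣≡-p δ
  where
  0≤q : 0ℚ ≤ e * ∣ δ ∣
  0≤q = subst (_≤ e * ∣ δ ∣) (*-zeroʳ e) (*-monoˡ-≤-nonNeg e {{ℚ.nonNegative (<⇒≤ 0<e)}} (0≤∣p∣ δ))
... | plus , minus | inj₁ eq rewrite eq = plus , minus
... | plus , minus | inj₂ eq rewrite eq =
  subst InUnit (solve 3 (λ x e δ → x :- e :* (:- δ) := x :+ e :* δ) refl x e δ) minus ,
  subst InUnit (solve 3 (λ x e δ → x :+ e :* (:- δ) := x :- e :* δ) refl x e δ) plus

slack-exists : ∀ {x} δ → InUnit x → (Is01 x → δ ≡ 0ℚ) → ∃ λ e → 0ℚ < e × Slack x (e * ∣ δ ∣)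
slack-exists {x} δ x∈@(0≤x , x≤1) off with is01? x
... | yes 01x rewrite off 01x = 1ℚ , positive⁻¹ 1ℚ , 0≤x , p≤q⇒0≤q-p x≤1
... | no frac = bound (≤-total x (1ℚ - x))
  where
  0<x : 0ℚ < x
  0<x = Frac-bounds frac x∈ .proj₁
  0<1-x : 0ℚ < 1ℚ - x
  0<1-x = subst (_< 1ℚ - x) (+-inverseʳ x) (+-monoˡ-< (- x) (Frac-bounds frac x∈ .proj₂))
  -- Adding 1 makes the divisor positive even for `δ = 0` while it still dominates `∣ δ ∣`; thus
  -- `e = t / β` gives `e * ∣ δ ∣ ≤ t`.
  β : ℚ
  β = 1ℚ + ∣ δ ∣
  instance
    β-pos : ℚ.Positive β
    β-pos = pos+nonNeg⇒pos 1ℚ ∣ δ ∣ {{∣-∣-nonNeg δ}}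
    β-nonZero : ℚ.NonZero β
    β-nonZero = pos⇒nonZero β
  ∣δ∣≤β : ∣ δ ∣ ≤ β
  ∣δ∣≤β = subst (_≤ β) (+-identityˡ ∣ δ ∣) (+-monoˡ-≤ ∣ δ ∣ (<⇒≤ (positive⁻¹ 1ℚ)))
  small : ∀ t → 0ℚ < t → ∃ λ e → 0ℚ < e × e * ∣ δ ∣ ≤ t
  small t 0<t = e , 0<e , subst (e * ∣ δ ∣ ≤_)
    (trans (*-assoc t (1/ β) β) (trans (cong (t *_) (*-inverseˡ β)) (*-identityʳ t)))
    (*-monoˡ-≤-nonNeg e {{ℚ.nonNegative (<⇒≤ 0<e)}} ∣δ∣≤β)
    where
    e : ℚ
    e = t * 1/ β
    0<e : 0ℚ < e
    0<e = subst (_< e) (*-zeroˡ (1/ β)) (*-monoˡ-<-pos (1/ β) {{1/pos⇒pos β}} 0<t)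
  bound : x ≤ 1ℚ - x ⊎ 1ℚ - x ≤ x → ∃ λ e → 0ℚ < e × Slack x (e * ∣ δ ∣)
  bound (inj₁ le) = let e , 0<e , small≤ = small x 0<x in e , 0<e , small≤ , ≤-trans small≤ le
  bound (inj₂ le) = let e , 0<e , small≤ = small (1ℚ - x) 0<1-x in e , 0<e , ≤-trans small≤ le , small≤

-- Takes the minimum of finitely many positive bounds; it is applied to rows and columns in turn.
common : ∀ {m} (P : Fin m → ℚ → Set) → (∀ i {e e′} → e′ ≤ e → P i e → P i e′) →
  (∀ i → ∃ λ e → 0ℚ < e × P i e) → ∃ λ e → 0ℚ < e × (∀ i → P i e)
common {zero} P down each = 1ℚ , positive⁻¹ 1ℚ , λ ()
common {suc m} P down each =
  let e , 0<e , p = each zero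
      e′ , 0<e′ , ps = common (P ∘ suc) (down ∘ suc) (each ∘ suc)
  in [ (λ e≤e′ → e , 0<e , λ { zero → p ; (suc i) → down (suc i) e≤e′ (ps i) })
     , (λ e′≤e → e′ , 0<e′ , λ { zero → down zero e′≤e p ; (suc i) → ps i }) ]′ (≤-total e e′)

Slack-down : ∀ {x δ e e′} → e′ ≤ e → Slack x (e * ∣ δ ∣) → Slack x (e′ * ∣ δ ∣)
Slack-down {δ = δ} e′≤e (p , q) = ≤-trans le p , ≤-trans le q
  where
  le = *-monoʳ-≤-nonNeg ∣ δ ∣ {{∣-∣-nonNeg δ}} e′≤e

pairVal-colsum : (x : Point n) → ∀ j → degSum x j ≡ colsum (pairVal x) j
pairVal-colsum x j = sumℚ-allFin (λ i → pairVal x i j)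

InP-matrix : (d : Fin n → ℕ) (Y : Mat n) → Symm Y → (∀ j → colsum Y j ≡ ι (ℤ.+ d j)) → (∀ i j → InUnit (Y i j)) → InP d Y
InP-matrix d Y sY deg unit =
  (λ j → trans (pairVal-colsum Y j) (trans (sum-cong-≗ λ i → pairVal-id sY i j) (deg j))) , λ i j _ → unit i j

InP-unit : (d : Fin n → ℕ) (x : Point n) → InP d x → ∀ i j → InUnit (pairVal x i j)
InP-unit d x (_ , unit) i j with <-cmp i j
... | tri< i<j _ _ = subst InUnit (sym (pairVal-< x i<j)) (unit i j i<j)
... | tri≈ _ refl _ = subst InUnit (sym (pairVal-Symm x .diag i)) (Is01⇒bounds (inj₁ refl))
... | tri> _ _ j<i = subst InUnit (sym (pairVal-> x j<i)) (unit j i j<i)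

InP-colsum : (d : Fin n → ℕ) (x : Point n) → InP d x → ∀ j → colsum (pairVal x) j ≡ ι (ℤ.+ d j)
InP-colsum d x (deg , _) j = trans (sym (pairVal-colsum x j)) (deg j)

colsum-linear : (X δ : Mat n) (e : ℚ) → (∀ j → colsum δ j ≡ 0ℚ) → ∀ j → colsum (λ i j → X i j + e * δ i j) j ≡ colsum X j
colsum-linear X δ e δ≡0 j = begin
  sum (λ i → X i j + e * δ i j)            ≡⟨ ∑-distrib-+ (λ i → X i j) (λ i → e * δ i j) ⟩
  colsum X j + sum (λ i → e * δ i j)       ≡⟨ cong (colsum X j +_) (trans (sym (*-distribˡ-sum e (λ i → δ i j))) (trans (cong (e *_) (δ≡0 j)) (*-zeroʳ e))) ⟩
  colsum X j + 0ℚ                          ≡⟨ +-identityʳ (colsum X j) ⟩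
  colsum X j                               ∎

Symm-linear : Symm X → Symm Y → ∀ e → Symm (λ i j → X i j + e * Y i j)
Symm-linear sX sY e .comm i j = cong₂ (λ x y → x + e * y) (sX .comm i j) (sY .comm i j)
Symm-linear sX sY e .diag i = trans (cong₂ (λ x y → x + e * y) (sX .diag i) (sY .diag i)) (trans (+-identityˡ (e * 0ℚ)) (*-zeroʳ e))

-- For small `e` both `V + e δ` and `V - e δ` lie in P(d), and their midpoint is the vertex. So they
-- coincide, and `e δ` is zero.
vertex-rigid : (d : Fin n → ℕ) (x : Point n) → IsVertex d x → Rigid (pairVal x)
vertex-rigid {n} d x (inP , extreme) δ sδ off δ-colsum =
  let e , 0<e , slack = common (λ i e → ∀ j → Slack (V i j) (e * ∣ δ i j ∣))
        (λ i le p j → Slack-down {V i j} {δ i j} le (p j))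
        (λ i → common (λ j e → Slack (V i j) (e * ∣ δ i j ∣)) (λ j → Slack-down {V i j} {δ i j})
          (λ j → slack-exists (δ i j) (InP-unit d x inP i j) (off i j)))
  in go e 0<e slack
  where
  V = pairVal x
  sV = pairVal-Symm x
  go : ∀ e → 0ℚ < e → (∀ i j → Slack (V i j) (e * ∣ δ i j ∣)) → ∀ i j → δ i j ≡ 0ℚ
  go e 0<e slack = Symm-ext sδ (record { comm = λ _ _ → refl ; diag = λ _ → refl }) λ i j i<j →
    *-cancel-≢0 (<⇒≢ 0<e ∘ sym) (half-zero (V i j) (δ i j) (extreme (λ i j → V i j + e * δ i j) (λ i j → V i j + - e * δ i j)
      (InP-matrix d (λ i j → V i j + e * δ i j) (Symm-linear sV sδ e) (λ j → trans (colsum-linear V δ e δ-colsum j) (InP-colsum d x inP j))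
        (λ i j → perturb i j .proj₁))
      (InP-matrix d (λ i j → V i j + - e * δ i j) (Symm-linear sV sδ (- e)) (λ j → trans (colsum-linear V δ (- e) δ-colsum j) (InP-colsum d x inP j))
        (λ i j → subst InUnit (solve 3 (λ x e δ → x :- e :* δ := x :+ (:- e) :* δ) refl (V i j) e (δ i j)) (perturb i j .proj₂)))
      (λ i j i<j → trans (cong (λ t → t + t) (sym (pairVal-< x i<j)))
        (solve 3 (λ x e δ → x :+ x := (x :+ e :* δ) :+ (x :+ (:- e) :* δ)) refl (V i j) e (δ i j)))
      i j i<j))
    where
    perturb : ∀ i j → InUnit (V i j + e * δ i j) × InUnit (V i j - e * δ i j)
    perturb i j = perturb-unit-∣∣ (InP-unit d x inP i j) 0<e (slack i j)
    half-zero : ∀ y t → y + e * t ≡ y + - e * t → e * t ≡ 0ℚ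
    half-zero y t eq = begin
      e * t
        ≡⟨ solve 3 (λ y e t → e :* t := con ½ :* ((y :+ e :* t) :- (y :+ (:- e) :* t))) refl y e t ⟩
      ½ * ((y + e * t) - (y + - e * t))
        ≡⟨ cong (λ s → ½ * (s - (y + - e * t))) eq ⟩
      ½ * ((y + - e * t) - (y + - e * t))
        ≡⟨ cong (½ *_) (+-inverseʳ (y + - e * t)) ⟩
      0ℚ ∎

33⇒Decisive : {d : Fin n → ℕ} → Graphic d → NoBlossoms33 d → Decisive d
33⇒Decisive {d = d} graphic none x vertex@(inP , _) i j i<j = subst Is01 (pairVal-< x i<j)
  (¬Frac⇒01 (no-Frac graphic none (suc (count (fractional (pairVal x)))) ℕ.≤-refl
    (record
      { symmetric = pairVal-Symm x
      ; bounds = InP-unit d x inP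
      ; integral = λ j → ℤ.+ d j , InP-colsum d x inP j
      ; rigid = vertex-rigid d x vertex })
    (InP-colsum d x inP) i j))

-- A fractional vertex from two triangles

nonNeg-sum-zero : ∀ {p q} → 0ℚ ≤ p → 0ℚ ≤ q → p + q ≡ 0ℚ → p ≡ 0ℚ
nonNeg-sum-zero {p} {q} 0≤p 0≤q eq =
  ≤-antisym (subst₂ _≤_ (+-identityʳ p) eq (+-monoʳ-≤ p 0≤q)) 0≤p

-- The numbers 0 and 1 are extreme points of the unit interval.
01-midpoint : ∀ {x p q} → Is01 x → InUnit p → InUnit q → x + x ≡ p + q → p - q ≡ 0ℚ
01-midpoint {_} {p} {q} (inj₁ refl) (0≤p , _) (0≤q , _) eq =
  cong₂ _-_ (nonNeg-sum-zero 0≤p 0≤q (sym eq)) (nonNeg-sum-zero 0≤q 0≤p (trans (+-comm q p) (sym eq)))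
01-midpoint {_} {p} {q} (inj₂ refl) (_ , p≤1) (_ , q≤1) eq =
  trans (solve 2 (λ p q → p :- q := (con 1ℚ :- q) :- (con 1ℚ :- p)) refl p q)
    (cong₂ _-_ (nonNeg-sum-zero (p≤q⇒0≤q-p q≤1) (p≤q⇒0≤q-p p≤1) (trans (+-comm (1ℚ - q) (1ℚ - p)) total))
      (nonNeg-sum-zero (p≤q⇒0≤q-p p≤1) (p≤q⇒0≤q-p q≤1) total))
  where
  total : (1ℚ - p) + (1ℚ - q) ≡ 0ℚ
  total = trans (solve 2 (λ p q → (con 1ℚ :- p) :+ (con 1ℚ :- q) := con (1ℚ + 1ℚ) :- (p :+ q)) refl p q)
    (trans (cong (λ s → (1ℚ + 1ℚ) - s) (sym eq)) (+-inverseʳ (1ℚ + 1ℚ)))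

-- The vertex-edge incidence matrix of a triangle is invertible.
triangle-zero : ∀ (δ : Mat n) {a b c} → Symm δ → (∀ j → colsum δ j ≡ 0ℚ) → a ≢ b → b ≢ c → a ≢ c →
  (∀ i j → i ∉ a ∷ b ∷ c ∷ [] → j ∈ a ∷ b ∷ c ∷ [] → δ i j ≡ 0ℚ) →
  ∀ i j → i ∈ a ∷ b ∷ c ∷ [] → j ∈ a ∷ b ∷ c ∷ [] → δ i j ≡ 0ℚ
triangle-zero δ {a} {b} {c} sδ δ≡0 a≢b b≢c a≢c outside = entry
  where
  out : ∀ i j → i ≢ a → i ≢ b → i ≢ c → j ∈ a ∷ b ∷ c ∷ [] → δ i j ≡ 0ℚ
  out i j i≢a i≢b i≢c = outside i j λ
    { (here p) → i≢a p ; (there (here p)) → i≢b p ; (there (there (here p))) → i≢c p }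
  at-a : δ a b + δ a c ≡ 0ℚ
  at-a = trans (cong₂ _+_ (sδ .comm a b) (sδ .comm a c)) (trans (sym (sum-two (λ i → δ i a) b≢c rest)) (δ≡0 a))
    where
    rest : ∀ i → i ≢ b → i ≢ c → δ i a ≡ 0ℚ
    rest i i≢b i≢c with i ≟ a
    ... | yes refl = sδ .diag i
    ... | no i≢a = out i a i≢a i≢b i≢c (here refl)
  at-b : δ a b + δ b c ≡ 0ℚ
  at-b = trans (cong (δ a b +_) (sδ .comm b c)) (trans (sym (sum-two (λ i → δ i b) a≢c rest)) (δ≡0 b))
    where
    rest : ∀ i → i ≢ a → i ≢ c → δ i b ≡ 0ℚ
    rest i i≢a i≢c with i ≟ b
    ... | yes refl = sδ .diag i
    ... | no i≢b = out i b i≢a i≢b i≢c (there (here refl))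
  at-c : δ a c + δ b c ≡ 0ℚ
  at-c = trans (sym (sum-two (λ i → δ i c) a≢b rest)) (δ≡0 c)
    where
    rest : ∀ i → i ≢ a → i ≢ b → δ i c ≡ 0ℚ
    rest i i≢a i≢b with i ≟ c
    ... | yes refl = sδ .diag i
    ... | no i≢c = out i c i≢a i≢b i≢c (there (there (here refl)))
  ab : δ a b ≡ 0ℚ
  ab = trans (solve 3 (λ x y z → x := con ½ :* ((x :+ y) :+ (x :+ z) :- (y :+ z))) refl (δ a b) (δ a c) (δ b c))
    (cong (½ *_) (cong₂ _-_ (cong₂ _+_ at-a at-b) at-c))
  ac : δ a c ≡ 0ℚ
  ac = trans (solve 3 (λ x y z → y := con ½ :* ((x :+ y) :+ (y :+ z) :- (x :+ z))) refl (δ a b) (δ a c) (δ b c))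
    (cong (½ *_) (cong₂ _-_ (cong₂ _+_ at-a at-c) at-b))
  bc : δ b c ≡ 0ℚ
  bc = trans (solve 3 (λ x y z → z := con ½ :* ((x :+ z) :+ (y :+ z) :- (x :+ y))) refl (δ a b) (δ a c) (δ b c))
    (cong (½ *_) (cong₂ _-_ (cong₂ _+_ at-b at-c) at-a))
  entry : ∀ i j → i ∈ a ∷ b ∷ c ∷ [] → j ∈ a ∷ b ∷ c ∷ [] → δ i j ≡ 0ℚ
  entry i j (here refl) (here refl) = sδ .diag i
  entry i j (here refl) (there (here refl)) = ab
  entry i j (here refl) (there (there (here refl))) = ac
  entry i j (there (here refl)) (here refl) = trans (sδ .comm i j) ab
  entry i j (there (here refl)) (there (here refl)) = sδ .diag i
  entry i j (there (here refl)) (there (there (here refl))) = bc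
  entry i j (there (there (here refl))) (here refl) = trans (sδ .comm i j) ac
  entry i j (there (there (here refl))) (there (here refl)) = trans (sδ .comm i j) bc
  entry i j (there (there (here refl))) (there (there (here refl))) = sδ .diag i

module _ {d : Fin n → ℕ} {X : Mat n} {x : ℚ} {a b c p q r : Fin n} (v : IsCycle p q r [])
  (B : Blossom X d x a b c [] p (q ∷ r ∷ [])) where

  private
    T T′ : List (Fin n)
    T = a ∷ b ∷ c ∷ []
    T′ = p ∷ q ∷ r ∷ []

    -- Moving a triangle to `½` changes the degree of its base point by `1 - 2x`. Exchanging the
    -- value `1 - x` of the pair `a p` for `x` makes up for this at both base points.
    L₁ L₂ W : Mat n
    L₁ = lay ½ p (q ∷ r ∷ []) p X
    L₂ = lay ½ a (b ∷ c ∷ []) a L₁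
    W = set a p x L₂

    01x : Is01 x
    01x = subst Is01 (alt₁ B .proj₁) (real B .is01 a b)

    a≢p : a ≢ p
    a≢p refl = disjoint B (here refl) (here refl)

    L₁-symm : Symm L₁
    L₁-symm = cycle-Symm p q r [] v ½ (real B .symm)

    L₂-symm : Symm L₂
    L₂-symm = cycle-Symm a b c [] (cycle B) ½ L₁-symm

    W-symm : Symm W
    W-symm = set-Symm a≢p L₂-symm

    miss₁ : ∀ i j → i ∈ T → L₁ i j ≡ X i j
    miss₁ i j i∈ = lay-miss X ½ p (q ∷ r ∷ []) p {i} {j} (inj₁ λ m → disjoint B i∈ (verts-closed p (q ∷ r ∷ []) m))

    miss₂ : ∀ i j → j ∈ T′ → L₂ i j ≡ L₁ i j
    miss₂ i j j∈ = lay-miss L₁ ½ a (b ∷ c ∷ []) a {i} {j} (inj₂ λ m → disjoint B (verts-closed a (b ∷ c ∷ []) m) j∈)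

    W-degrees : ∀ j → colsum W j ≡ ι (ℤ.+ d j)
    W-degrees j = begin
      colsum W j
        ≡⟨ set-colsum a≢p L₂-symm j ⟩
      colsum L₂ j + (x - L₂ a p) * (ind a j + ind p j)
        ≡⟨ cong₂ (λ C y → C + (x - y) * (ind a j + ind p j)) colsum₂
             (trans (miss₂ a p (here refl)) (trans (miss₁ a p (here refl)) (link B))) ⟩
      colsum X j + (s * ind p j + - (- s) * ind p j) + (s * ind a j + - (- s) * ind a j) + (x - (1ℚ - x)) * (ind a j + ind p j)
        ≡⟨ solve 4 (λ C x a p → C :+ ((con ½ :- x) :* p :+ :- (:- (con ½ :- x)) :* p)
                               :+ ((con ½ :- x) :* a :+ :- (:- (con ½ :- x)) :* a)
                               :+ (x :- (con 1ℚ :- x)) :* (a :+ p) := C) refl (colsum X j) x (ind a j) (ind p j) ⟩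
      colsum X j
        ≡⟨ real B .degrees j ⟩
      ι (ℤ.+ d j) ∎
      where
      s = ½ - x
      colsum₂ : colsum L₂ j ≡ colsum X j + (s * ind p j + - (- s) * ind p j) + (s * ind a j + - (- s) * ind a j)
      colsum₂ = trans
        (cycle-colsum a b c [] (cycle B) ½ x L₁-symm
          (AltM-cong-∈ {X = X} x a (b ∷ c ∷ []) a (λ {i} {j} i∈ _ → miss₁ i j (verts-closed a (b ∷ c ∷ []) i∈)) (alt₁ B)) j)
        (cong (_+ (s * ind a j + - (- s) * ind a j)) (cycle-colsum p q r [] v ½ x (real B .symm) (alt₂ B) j))

    -- Bounds are carried together with the places where `W` may be fractional: only inside one of
    -- the two triangles.
    Place : Fin n → Fin n → ℚ → Set
    Place i j w = InUnit w × (Is01 w ⊎ (i ∈ T × j ∈ T) ⊎ (i ∈ T′ × j ∈ T′))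

    half∈ : InUnit ½
    half∈ = *≤* (ℤ.+≤+ ℕ.z≤n) , *≤* (ℤ.+≤+ (ℕ.s≤s ℕ.z≤n))

    place : ∀ i j → Place i j (W i j)
    place = set-elim Place at-x at-x
      (lay-elim-inside T inj₁ a (b ∷ c ∷ []) a (λ m → verts-closed a (b ∷ c ∷ []) m)
        (lay-elim-inside T′ inj₂ p (q ∷ r ∷ []) p (λ m → verts-closed p (q ∷ r ∷ []) m)
          λ i j → Is01⇒bounds (real B .is01 i j) , inj₁ (real B .is01 i j)))
      where
      at-x : ∀ {i j} → Place i j x
      at-x = Is01⇒bounds 01x , inj₁ 01x
      lay-elim-inside : ∀ (S : List (Fin n)) →
        (∀ {i j} → i ∈ S × j ∈ S → (i ∈ T × j ∈ T) ⊎ (i ∈ T′ × j ∈ T′)) →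
        ∀ a bs z → (∀ {i} → i ∈ verts a bs z → i ∈ S) → {Y : Mat n} →
        (∀ i j → Place i j (Y i j)) → ∀ i j → Place i j (lay ½ a bs z Y i j)
      lay-elim-inside S inS a [] z sub pY = set-elim Place
        (half∈ , inj₂ (inS (sub (here refl) , sub (there (here refl)))))
        (half∈ , inj₂ (inS (sub (there (here refl)) , sub (here refl)))) pY
      lay-elim-inside S inS a (b ∷ bs) z sub pY = set-elim Place
        (half∈ , inj₂ (inS (sub (here refl) , sub (there (here refl)))))
        (half∈ , inj₂ (inS (sub (there (here refl)) , sub (here refl))))
        (lay-elim-inside S inS b bs z (sub ∘ there) pY)

    W-InP : InP d W
    W-InP = InP-matrix d W W-symm W-degrees (λ i j → place i j .proj₁)

    distinct : ∀ {a b c : Fin n} → IsCycle a b c [] → a ≢ b × b ≢ c × a ≢ c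
    distinct u@(_ ∷ u′) = head≢ u (there (here refl)) ∘ sym , head≢ u (here refl) , head≢ u′ (here refl) ∘ sym

    -- A perturbation vanishes on all pairs that leave a triangle, so the column sums at its
    -- vertices involve only its three edges.
    W-rigid : Rigid W
    W-rigid δ sδ off δ≡0 i j with place i j .proj₂
    ... | inj₁ 01w = off i j 01w
    ... | inj₂ (inj₁ (i∈ , j∈)) = let a≢b , b≢c , a≢c = distinct (cycle B) in
      triangle-zero δ sδ δ≡0 a≢b b≢c a≢c (λ i j i∉ j∈ → off i j (case place i j .proj₂ of λ
        { (inj₁ 01w) → 01w
        ; (inj₂ (inj₁ (i∈ , _))) → contradiction i∈ i∉
        ; (inj₂ (inj₂ (_ , j∈′))) → contradiction j∈′ (disjoint B j∈) })) i j i∈ j∈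
    ... | inj₂ (inj₂ (i∈ , j∈)) = let p≢q , q≢r , p≢r = distinct v in
      triangle-zero δ sδ δ≡0 p≢q q≢r p≢r (λ i j i∉ j∈ → off i j (case place i j .proj₂ of λ
        { (inj₁ 01w) → 01w
        ; (inj₂ (inj₁ (_ , j∈′))) → contradiction j∈ (disjoint B j∈′)
        ; (inj₂ (inj₂ (i∈ , _))) → contradiction i∈ i∉ })) i j i∈ j∈

    W-half : W a b ≡ ½
    W-half = trans (set-miss a p x L₂ {a} {b} λ
      { (inj₁ (_ , refl)) → disjoint B (there (here refl)) (here refl)
      ; (inj₂ (refl , _)) → a≢p refl }) (set-hit a b ½ (lay (1ℚ - ½) b (c ∷ []) a L₁))

  -- If `W` is the midpoint of two points of P(d), their difference vanishes where `W` is 0 or 1 and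
  -- has zero column sums, so `W-rigid` makes it zero.
  triangles-vertex : IsVertex d W
  triangles-vertex = W-InP , λ y z y∈ z∈ mid i j i<j → midpoint y z y∈ z∈ mid i<j
    where
    midpoint : ∀ y z → InP d y → InP d z → (∀ i j → i Fin.< j → W i j + W i j ≡ y i j + z i j) →
      ∀ {i j} → i Fin.< j → y i j ≡ z i j
    midpoint y z y∈ z∈ mid {i} {j} i<j = begin
      y i j                    ≡⟨ sym (pairVal-< y i<j) ⟩
      V i j                    ≡⟨ solve 2 (λ s t → s := (s :+ con (- 1ℚ) :* t) :+ t) refl (V i j) (U i j) ⟩
      δ i j + U i j            ≡⟨ cong (_+ U i j) (W-rigid δ δ-symm δ-off δ-colsum i j) ⟩
      0ℚ + U i j               ≡⟨ +-identityˡ (U i j) ⟩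
      U i j                    ≡⟨ pairVal-< z i<j ⟩
      z i j                    ∎
      where
      V U δ : Mat n
      V = pairVal y
      U = pairVal z
      δ i j = V i j + - 1ℚ * U i j
      δ-symm : Symm δ
      δ-symm = Symm-linear (pairVal-Symm y) (pairVal-Symm z) (- 1ℚ)
      mid-all : ∀ i j → W i j + W i j ≡ V i j + U i j
      mid-all = Symm-ext
        (record { comm = λ i j → cong (λ t → t + t) (W-symm .comm i j) ; diag = λ i → cong (λ t → t + t) (W-symm .diag i) })
        (record { comm = λ i j → cong₂ _+_ (pairVal-Symm y .comm i j) (pairVal-Symm z .comm i j)
                ; diag = λ i → cong₂ _+_ (pairVal-Symm y .diag i) (pairVal-Symm z .diag i) })
        λ i j i<j → trans (mid i j i<j) (sym (cong₂ _+_ (pairVal-< y i<j) (pairVal-< z i<j)))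
      δ-off : ∀ i j → Is01 (W i j) → δ i j ≡ 0ℚ
      δ-off i j 01w = trans (solve 2 (λ s t → s :+ con (- 1ℚ) :* t := s :- t) refl (V i j) (U i j))
        (01-midpoint 01w (InP-unit d y y∈ i j) (InP-unit d z z∈ i j) (mid-all i j))
      δ-colsum : ∀ j → colsum δ j ≡ 0ℚ
      δ-colsum j = begin
        sum (λ i → V i j + - 1ℚ * U i j)
          ≡⟨ ∑-distrib-+ (λ i → V i j) (λ i → - 1ℚ * U i j) ⟩
        colsum V j + sum (λ i → - 1ℚ * U i j)
          ≡⟨ cong (colsum V j +_) (sym (*-distribˡ-sum (- 1ℚ) (λ i → U i j))) ⟩
        colsum V j + - 1ℚ * colsum U j
          ≡⟨ cong₂ (λ s t → s + - 1ℚ * t) (InP-colsum d y y∈ j) (InP-colsum d z z∈ j) ⟩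
        ι (ℤ.+ d j) + - 1ℚ * ι (ℤ.+ d j)
          ≡⟨ solve 1 (λ t → t :+ con (- 1ℚ) :* t := con 0ℚ) refl (ι (ℤ.+ d j)) ⟩
        0ℚ ∎

  triangles⇒¬Decisive : ¬ Decisive d
  triangles⇒¬Decisive decisive = ½∉ (subst Is01 W-half W-01)
    where
    ½∉ : ¬ Is01 ½
    ½∉ (inj₁ ())
    ½∉ (inj₂ ())
    W-01 : Is01 (W a b)
    W-01 with <-cmp a b
    ... | tri< a<b _ _ = decisive W triangles-vertex a b a<b
    ... | tri≈ _ a≡b _ = contradiction a≡b (distinct (cycle B) .proj₁)
    ... | tri> _ _ b<a = subst Is01 (W-symm .comm b a) (decisive W triangles-vertex b a b<a)

-- The cycles are shrunk first, so that the fractional vertex has to be constructed for triangles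
-- only.
Decisive⇒NoBlossoms : {d : Fin n → ℕ} → Decisive d → NoBlossoms d
Decisive⇒NoBlossoms {d = d} decisive G realizes k l odd-k 3≤k odd-l 3≤l blossom =
  go (HasBlossom⇒TriangleBlossom (IntegralBlossom⇒HasBlossom G realizes k l odd-k 3≤k odd-l 3≤l blossom))
  where
  go : TriangleBlossom d → ⊥
  go (triangles v B) = triangles⇒¬Decisive v B decisive

theorem2 : ∀ (n : ℕ) (d : Fin n → ℕ) → Graphic d →
    (Decisive d ⇔ NoBlossoms d) × (NoBlossoms d ⇔ NoBlossoms33 d)
theorem2 n d graphic =
  mk⇔ Decisive⇒NoBlossoms (λ none → 33⇒Decisive graphic (NoBlossoms⇒33 none)) ,
  mk⇔ NoBlossoms⇒33 33⇒NoBlossoms
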